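{- Let $n$ be an even positive integer. Then there exists a 2-cell embedding of the complete bipartite graph $K_{n,n}$ into the closed orientable surface $\mathbb{S}_g$ of genus $g=\left\lceil \frac{(n-1)(n-2)}{4}\right\rceil$ such that one of the faces of the embedding is bounded by a Hamiltonian cycle of $K_{n,n}$.
   Context: $\mathbb{S}_g$ denotes the closed orientable surface of genus $g$ (the sphere with $g$ handles). An embedding of a graph into a surface is 2-cell if the interior of every face (region of the complement of the embedded graph) is homeomorphic to an open disk. A face is bounded by a cycle $C$ if its boundary walk is exactly $C$. -}

module Defs where

open import Data.Empty using (⊥)
open import Data.Fin using (Fin)
open import Data.Nat using (ℕ; suc; _+_; _*_; _≤_; _<_; _/_)
open import Data.Nat.GeneralisedArithmetic using (fold)
open import Data.Product using (∃; ∃-syntax; _×_; _,_)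
open import Data.Sum using (_⊎_; inj₁; inj₂)
open import Data.Unit using (⊤; tt)
open import Function.Bundles using (_↔_; _⇔_; module Inverse)
open import Relation.Binary.Construct.Closure.ReflexiveTransitive using (Star)
open import Relation.Binary.Core using (Rel)
open import Relation.Binary.Definitions using (Symmetric; Irreflexive; Irrelevant; Universal)
open import Relation.Binary.PropositionalEquality using (_≡_; refl)

⌈_/4⌉ : ℕ → ℕ
⌈ m /4⌉ = (m + 3) / 4

-- `adj-irrelevant` excludes multiple edges.
record Graph : Set₁ where
  field
    Vertex         : Set
    Adj            : Rel Vertex _
    adj-sym        : Symmetric Adj
    adj-irrefl     : Irreflexive _≡_ Adj
    adj-irrelevant : Irrelevant Adj

completeBipartite : ℕ → ℕ → Graph
completeBipartite m n = record
  { Vertex         = Fin m ⊎ Fin n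
  ; Adj            = Adj
  ; adj-sym        = λ {x} {y} → adj-sym x y
  ; adj-irrefl     = λ {x} {y} → adj-irrefl x y
  ; adj-irrelevant = λ {x} {y} → adj-irrelevant x y
  }
  where
  Adj : Rel (Fin m ⊎ Fin n) _
  Adj (inj₁ _) (inj₂ _) = ⊤
  Adj (inj₂ _) (inj₁ _) = ⊤
  Adj (inj₁ _) (inj₁ _) = ⊥
  Adj (inj₂ _) (inj₂ _) = ⊥

  adj-sym : ∀ x y → Adj x y → Adj y x
  adj-sym (inj₁ _) (inj₂ _) _ = tt
  adj-sym (inj₂ _) (inj₁ _) _ = tt

  adj-irrefl : ∀ x y → x ≡ y → Adj x y → ⊥
  adj-irrefl (inj₁ _) _ refl ()
  adj-irrefl (inj₂ _) _ refl ()

  adj-irrelevant : ∀ x y → (p q : Adj x y) → p ≡ q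
  adj-irrelevant (inj₁ _) (inj₂ _) _ _ = refl
  adj-irrelevant (inj₂ _) (inj₁ _) _ _ = refl

-- `R` is an equivalence relation with exactly `k` classes.
record Classes {A : Set} (R : Rel A _) (k : ℕ) : Set where
  field
    class      : A → Fin k
    surjective : ∀ i → ∃[ a ] class a ≡ i
    class-⇔    : ∀ a b → R a b ⇔ class a ≡ class b

module _ (G : Graph) where
  open Graph G

  Connected : Set
  Connected = Universal (Star Adj)

  Neighbour : Vertex → Set
  Neighbour v = ∃ (Adj v)

  -- An edge together with one of its two directions.
  record Dart : Set where
    constructor dart
    field
      tail head : Vertex
      adjacent  : Adj tail head

  reverse : Dart → Dart
  reverse (dart u v a) = dart v u (adj-sym a)

  SameEdge : Rel Dart _
  SameEdge d d′ = d ≡ d′ ⊎ reverse d ≡ d′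

  -- At each vertex, a cyclic permutation of the incident edges (in a simple
  -- graph: of the neighbours).
  record RotationSystem : Set where
    field
      rotation : ∀ v → Neighbour v ↔ Neighbour v
      cyclic   : ∀ v (x y : Neighbour v) →
                 ∃[ k ] fold x (Inverse.to (rotation v)) k ≡ y

    -- Face traversal: traverse the edge uv, then leave v along the edge
    -- following it in the rotation at v.
    traverse : Dart → Dart
    traverse (dart u v a) with Inverse.to (rotation v) (u , adj-sym a)
    ... | w , b = dart v w b

    -- On a finite graph `traverse` is a permutation, so forward iterates
    -- already give the whole orbit.
    SameFace : Rel Dart _
    SameFace d d′ = ∃[ k ] fold d traverse k ≡ d′

  -- 2-cell embeddings of a connected graph (with at least one edge) into
  -- closed oriented surfaces, up to orientation-preserving homeomorphism fixing
  -- the graph, are its rotation systems (Heffter–Edmonds): the surface arises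
  -- by gluing a disk along every orbit of `traverse`.  Its genus g is given by
  -- Euler's formula  v - e + f = 2 - 2g.
  record TwoCellEmbedding (g : ℕ) : Set where
    field
      connected      : Connected
      rotationSystem : RotationSystem
    open RotationSystem rotationSystem public
    field
      {#vertices #edges #faces} : ℕ
      vertices : Vertex ↔ Fin #vertices
      edges    : Classes SameEdge #edges
      faces    : Classes SameFace #faces
      euler    : #vertices + #faces + 2 * g ≡ #edges + 2

    Face : Set
    Face = Fin #faces

    faceOf : Dart → Face
    faceOf = Classes.class faces

  -- A cycle is written as a periodic sequence of vertices, v₀ … vₗ₋₁ v₀ …
  record Cycle : Set where
    field
      length   : ℕ
      3≤length : 3 ≤ length
      vertex   : ℕ → Vertex
      periodic : ∀ i → vertex (i + length) ≡ vertex i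
      adjacent : ∀ i → Adj (vertex i) (vertex (suc i))
      distinct : ∀ {i j} → i < length → j < length → vertex i ≡ vertex j → i ≡ j

  Hamiltonian : Cycle → Set
  Hamiltonian C = ∀ v → ∃[ i ] Cycle.vertex C i ≡ v

  -- The boundary walk of the face, started at a suitable dart, is C.  (The
  -- graph being simple, equality of the vertex sequences implies that the walk
  -- closes up after exactly `length` steps.)
  BoundedBy : ∀ {g} (E : TwoCellEmbedding g) → TwoCellEmbedding.Face E → Cycle → Set
  BoundedBy E F C =
    ∃[ d ] (faceOf d ≡ F × (∀ i → Dart.tail (fold d traverse i) ≡ Cycle.vertex C i))
    where open TwoCellEmbedding E

{-# OPTIONS --safe #-}
module Submission where

open import Defs
open import Data.Bool using (Bool; true; false; if_then_else_)
open import Data.Empty using (⊥)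
open import Data.Fin using (Fin; zero; suc; toℕ; fromℕ; fromℕ<; inject₁; punchOut; punchIn; combine; _≟_)
open import Data.Fin.Induction using (<-weakInduction; >-weakInduction)
open import Data.Fin.Patterns
import Data.Fin.Properties as Fin
open import Data.Fin.Relation.Unary.Top using (view; ‵fromℕ; ‵inject₁; view-fromℕ; view-inject₁)
open import Data.Maybe using (Maybe; just; nothing; maybe′)
open import Data.Maybe.Properties using (just-injective)
open import Data.Nat using (ℕ; zero; suc; _+_; _*_; _∸_; _≤_; _<_; _/_; _%_; z≤n; s≤s; NonZero; >-nonZero)
open import Data.Nat.Divisibility using (_∣_; divides; n∣m*n)
open import Data.Nat.DivMod using (m≡m%n+[m/n]*n; m%n<n; m<n⇒m/n≡0; m*n/n≡m; +-distrib-/-∣ʳ)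
open import Data.Nat.GeneralisedArithmetic using (fold; fold-+)
import Data.Nat.Properties as ℕ
open import Data.Nat.Solver using (module +-*-Solver)
open import Data.Product using (Σ-syntax; ∃-syntax; _×_; _,_; proj₁; proj₂)
open import Data.Sum using (_⊎_; inj₁; inj₂)
open import Data.Sum.Function.Propositional using (_⊎-↔_)
open import Data.Unit using (tt)
open import Data.Vec using (Vec; []; _∷_; lookup)
open import Function using (_∘_; id; _↔_; mk↔ₛ′; Inverse; Equivalence; mk⇔)
open import Function.Construct.Composition using (_↔-∘_)
open import Function.Construct.Identity using (↔-id)
open import Function.Construct.Symmetry using (↔-sym)
open import Relation.Binary.Construct.Closure.ReflexiveTransitive using (ε; _◅_)
open import Relation.Binary.PropositionalEquality
open import Relation.Nullary using (¬_; Dec; yes; no; contradiction)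
open import Relation.Nullary.Decidable using (map′; from-yes; _×-dec_)

-- Enlarge K_{n,n} by a vertex ∞ to K_{n,n+1}: a quadrilateral embedding in which
-- the faces at ∞ have distinct fourth vertices becomes an embedding of K_{n,n}
-- with a Hamiltonian face once ∞ is deleted.  If the rotations at the n+1
-- vertices alternate between two halves of the other n vertices, then such an
-- embedding is a gluing of n/2 white and n/2 black (n+1)-gons along arcs.
--
-- For n = 2m with m = 2r+1 odd, the vertices of the polygons are x_a (a ∈ ℤ/m) and
-- f_j, g_j (0 ≤ j ≤ r).  The white polygons W_i are the translates x_a ↦ x_{a+i} of
--   x_0 f_0 g_0 x_1 x_{-1} f_1 g_1 x_2 x_{-2} f_2 g_2 … x_r x_{-r} f_r g_r,
-- the black ones those of the same cyclic sequence with f_{j+1}, g_{j+1} for f_j, g_j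
-- (j modulo r+1); ∞ is x_0.
--
-- For n = 2m + 2 with m = 2r+1 ≥ 3 one inserts P between f_r and g_r, and Q between
-- f_0 and g_0, takes ∞ = x_{-r}, and replaces W_0 by two white polygons and a black one.
-- Euler's formula leaves room for one octagon, which appears at f_r.  The case n = 4
-- is a table.

-- The genus is the least that Euler's formula permits when one face has length 2n and all others
-- have length at least 4. For 4 | n this bound is a half-integer, so one face has to be given up.
-- An arc x → f, x → x or g → x occurs in one polygon of each colour, which fixes its gluing; an arc
-- f_j → g_j occurs in all of them and is glued by equal numbers. The rotation at f_j or g_j is then
-- a translation of ℤ/m by 1 or by half of 1, and both generate because m is odd. Oddness also makes
-- any two x's consecutive in just one polygon of each colour, the one centred at their midpoint;
-- this gives the distinct fourth vertices at ∞. Before the surgery on W_0, P and Q have only arcs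
-- of the free kind. Equal numbers would make the rotation at P and Q the identity, hence the gluing
-- there is shifted. P and Q need different places, which excludes r = 0, that is n = 4. In the
-- surgery the two new white polygons have to alternate along the n + 1 vertices of W_0. As n + 1 is
-- odd, the alternation fails somewhere, and this failure is the octagon.

private variable
  A B : Set

-- Orbits, cyclic maps and counting.

Reach : (A → A) → A → A → Set
Reach f x y = ∃[ k ] fold x f k ≡ y

Cyclic : (A → A) → Set
Cyclic f = ∀ x y → Reach f x y

reach-refl : {f : A → A} {x : A} → Reach f x x
reach-refl = 0 , refl

reach-≡ : {f : A → A} {x y : A} → x ≡ y → Reach f x y
reach-≡ eq = 0 , eq

reach-step : {f : A → A} {x y : A} → f x ≡ y → Reach f x y
reach-step eq = 1 , eq

infixr 5 _⨾_

_⨾_ : {f : A → A} {x y z : A} → Reach f x y → Reach f y z → Reach f x z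
_⨾_ {f = f} {x} (k , refl) (l , refl) = l + k , fold-+ x f l

fold-shift : (f : A → A) (x : A) (k : ℕ) → fold (f x) f k ≡ f (fold x f k)
fold-shift f x zero    = refl
fold-shift f x (suc k) = cong f (fold-shift f x k)

fold-unstep : (f : A → A) (x : A) (k : ℕ) {y : A} → fold x f (suc k) ≡ y → fold (f x) f k ≡ y
fold-unstep f x k eq = trans (fold-shift f x k) eq

reach-lift : {f : A → A} {g : B → B} (h : A → B) →
             (∀ a → Reach g (h a) (h (f a))) →
             ∀ {x y} → Reach f x y → Reach g (h x) (h y)
reach-lift h lift (zero  , refl) = reach-refl
reach-lift h lift {x} (suc k , refl) = reach-lift h lift (k , refl) ⨾ lift _

reach-invariant : {f : A → A} (h : A → B) → (∀ a → h (f a) ≡ h a) →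
                  ∀ {x y} → Reach f x y → h x ≡ h y
reach-invariant h inv (zero  , refl) = refl
reach-invariant h inv (suc k , refl) =
  trans (reach-invariant h inv (k , refl)) (sym (inv _))

-- The image of `h` only has to be a cross-section: every point leads into it and is reached from
-- it. Long cycles are checked on such sections.
cyclic-lift : {f : A → A} {g : B → B} (h : A → B) → Cyclic f →
              (∀ a → Reach g (h a) (h (f a))) →
              (∀ b → ∃[ a ] Reach g (h a) b) →
              (∀ b → ∃[ a ] Reach g b (h a)) →
              Cyclic g
cyclic-lift h cyc lift from to x y with to x | from y
... | a , x↝a | b , b↝y = x↝a ⨾ reach-lift h lift (cyc a b) ⨾ b↝y

cyclic-conj : {f : A → A} {g : B → B} (h : A → B) → Cyclic f →
              (∀ a → g (h a) ≡ h (f a)) → (∀ b → ∃[ a ] h a ≡ b) → Cyclic g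
cyclic-conj h cyc comm surj = cyclic-lift h cyc (λ a → reach-step (comm a))
  (λ b → let a , eq = surj b in a , reach-≡ eq)
  (λ b → let a , eq = surj b in a , reach-≡ (sym eq))

cyclic-≗ : {f g : A → A} → (∀ x → f x ≡ g x) → Cyclic f → Cyclic g
cyclic-≗ f≗g cyc = cyclic-conj id cyc (λ x → sym (f≗g x)) (λ x → x , refl)

cyclic-hub : {f : A → A} (h : A) → (∀ x → Reach f h x) → (∀ x → Reach f x h) → Cyclic f
cyclic-hub h from to x y = to x ⨾ from y

module _ {f : A → A} (cyc : Cyclic f) where

  -- `f x` returns to `x` after k steps, so k + 1 steps fix `x` and, along its orbit, every other
  -- point. Hence k further steps undo `f` everywhere.
  cyclic-injective : ∀ {x y} → f x ≡ f y → x ≡ y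
  cyclic-injective {x} {y} fx≡fy with cyc (f x) x
  ... | k , eq = begin
    x                ≡⟨ eq ⟨
    fold (f x) f k   ≡⟨ cong (λ z → fold z f k) fx≡fy ⟩
    fold (f y) f k   ≡⟨ back ⟩
    y                ∎
    where
    open ≡-Reasoning
    orbit : ∀ l → fold (f x) f k ≡ x → fold (fold x f l) f (suc k) ≡ fold x f l
    orbit l eq = begin
      fold (fold x f l) f (suc k) ≡⟨ fold-+ x f (suc k) ⟨
      fold x f (suc k + l)        ≡⟨ cong (fold x f) (ℕ.+-comm (suc k) l) ⟩
      fold x f (l + suc k)        ≡⟨ fold-+ x f l ⟩
      fold (fold x f (suc k)) f l ≡⟨ cong (λ z → fold z f l) (trans (sym (fold-shift f x k)) eq) ⟩
      fold x f l                  ∎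
    back : fold (f y) f k ≡ y
    back with cyc x y
    ... | l , refl = trans (fold-shift f (fold x f l) k) (orbit l eq)

  abstract
    inverse : A → A
    inverse y = fold y f (proj₁ (cyc (f y) y))

    inverseʳ : ∀ y → f (inverse y) ≡ y
    inverseʳ y with cyc (f y) y
    ... | k , eq = trans (sym (fold-shift f y k)) eq

    inverseˡ : ∀ x → inverse (f x) ≡ x
    inverseˡ x = cyclic-injective (inverseʳ (f x))

  inverse-unique : ∀ {x y} → f x ≡ y → inverse y ≡ x
  inverse-unique {x} refl = inverseˡ x

  -- `g` walks back along the orbits of `f`, so a path of `f` from `y` to `x` becomes a path of `g`
  -- from `x` to `y`.
  cyclic-leftInverse : {g : A → A} → (∀ x → g (f x) ≡ x) → Cyclic g
  cyclic-leftInverse {g} gf x y with cyc y x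
  ... | k , refl = k , undo k y
    where
    undo : ∀ k y → fold (fold y f k) g k ≡ y
    undo zero    y = refl
    undo (suc k) y = trans (sym (fold-shift g (f (fold y f k)) k))
                           (trans (cong (λ z → fold z g k) (gf _)) (undo k y))

  cyclic-rightInverse : {g : A → A} → (∀ x → f (g x) ≡ x) → Cyclic g
  cyclic-rightInverse fg = cyclic-leftInverse (λ x → cyclic-injective (fg (f x)))

  inverse-cyclic : Cyclic inverse
  inverse-cyclic = cyclic-leftInverse inverseˡ

  cyclic↔ : A ↔ A
  cyclic↔ = mk↔ₛ′ f inverse inverseʳ inverseˡ

fold-reduce : (f : A → A) (x : A) (p : ℕ) .{{_ : NonZero p}} → fold x f p ≡ x →
              ∀ k → fold x f k ≡ fold x f (k % p)
fold-reduce f x p per k = begin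
  fold x f k                          ≡⟨ cong (fold x f) (m≡m%n+[m/n]*n k p) ⟩
  fold x f (k % p + k / p * p)        ≡⟨ fold-+ x f (k % p) ⟩
  fold (fold x f (k / p * p)) f (k % p) ≡⟨ cong (λ z → fold z f (k % p)) (multiple (k / p)) ⟩
  fold x f (k % p)                    ∎
  where
  open ≡-Reasoning
  multiple : ∀ q → fold x f (q * p) ≡ x
  multiple zero    = refl
  multiple (suc q) = trans (fold-+ x f p) (trans (cong (λ z → fold z f p) (multiple q)) per)

surjection⇒≤ : ∀ {m n} (s : Fin m → Fin n) → (∀ j → ∃[ i ] s i ≡ j) → n ≤ m
surjection⇒≤ s surj = Fin.injective⇒≤ {f = proj₁ ∘ surj} λ {x} {y} eq →
  trans (sym (proj₂ (surj x))) (trans (cong s eq) (proj₂ (surj y)))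

-- If i ≠ j had the same value, `s` would stay onto after the removal of i, contrary to the count of
-- elements.
surjection-injective : ∀ {n} (s : Fin n → Fin n) → (∀ j → ∃[ i ] s i ≡ j) →
                       ∀ {i j} → s i ≡ s j → i ≡ j
surjection-injective {suc n} s surj {i} {j} si≡sj with i ≟ j
... | yes i≡j = i≡j
... | no  i≢j = contradiction (surjection⇒≤ (s ∘ punchIn i) surj′) (ℕ.<⇒≱ ℕ.≤-refl)
  where
  surj′ : ∀ v → ∃[ u ] s (punchIn i u) ≡ v
  surj′ v with surj v
  ... | u , su≡v with i ≟ u
  ...   | yes refl = punchOut i≢j ,
                     trans (cong s (Fin.punchIn-punchOut i≢j)) (trans (sym si≡sj) su≡v)
  ...   | no  i≢u  = punchOut i≢u , trans (cong s (Fin.punchIn-punchOut i≢u)) su≡v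

-- The pigeonhole principle gives a period p ≤ m; the points of one period exhaust `Fin m`, so p =
-- m.
cyclic-period : ∀ {m} (f : Fin m → Fin m) → Cyclic f → ∀ x → fold x f m ≡ x
cyclic-period {m} f cyc x with Fin.pigeonhole ℕ.≤-refl (λ (k : Fin (suc m)) → fold x f (toℕ k))
... | i , j , i<j , eq = subst (λ k → fold x f k ≡ x) p≡m period
  where
  p : ℕ
  p = toℕ j ∸ toℕ i
  cancel : ∀ k {y z} → fold y f k ≡ fold z f k → y ≡ z
  cancel zero    e = e
  cancel (suc k) e = cancel k (cyclic-injective cyc e)
  period : fold x f p ≡ x
  period = cancel (toℕ i) (trans (sym (fold-+ x f (toℕ i)))
    (trans (cong (fold x f) (ℕ.m+[n∸m]≡n (ℕ.<⇒≤ i<j))) (sym eq)))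
  instance
    p≢0 : NonZero p
    p≢0 = >-nonZero (ℕ.m<n⇒0<n∸m i<j)
  m≤p : m ≤ p
  m≤p = surjection⇒≤ (λ (k : Fin p) → fold x f (toℕ k)) λ y →
    let k , e = cyc x y in
    fromℕ< (m%n<n k p) ,
    trans (cong (fold x f) (Fin.toℕ-fromℕ< (m%n<n k p))) (trans (sym (fold-reduce f x p period k)) e)
  p≡m : p ≡ m
  p≡m = ℕ.≤-antisym (ℕ.≤-trans (ℕ.m∸n≤m (toℕ j) (toℕ i)) (ℕ.≤-pred (Fin.toℕ<n j))) m≤p

-- Deletion of a point from a cyclic order; orbits by first return.

-- V is the disjoint union of {∞} and the image of B.
module Deletion {V B : Set} (∞ : V) (⟦_⟧ : B → V)
  (⟦⟧-injective : ∀ {b c} → ⟦ b ⟧ ≡ ⟦ c ⟧ → b ≡ c)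
  (⟦⟧≢∞ : ∀ {b} → ⟦ b ⟧ ≢ ∞)
  (split : ∀ v → v ≡ ∞ ⊎ ∃[ b ] v ≡ ⟦ b ⟧) where

  abstract
    skip : (V → V) → B → B
    skip f b with split (f ⟦ b ⟧)
    ... | inj₂ (c , _) = c
    ... | inj₁ _ with split (f ∞)
    ...   | inj₂ (c , _) = c
    -- A default: by `fixed-∞`, a cyclic `f` does not fix `∞` once some `⟦ b ⟧` exists.
    ...   | inj₁ _       = b

    skip-direct : ∀ {f b c} → f ⟦ b ⟧ ≡ ⟦ c ⟧ → skip f b ≡ c
    skip-direct {f} {b} eq with split (f ⟦ b ⟧)
    ... | inj₂ (c , e) = ⟦⟧-injective (trans (sym e) eq)
    ... | inj₁ e = contradiction (trans (sym eq) e) ⟦⟧≢∞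

    skip-∞ : ∀ {f b c} → f ⟦ b ⟧ ≡ ∞ → f ∞ ≡ ⟦ c ⟧ → skip f b ≡ c
    skip-∞ {f} {b} eq₁ eq₂ with split (f ⟦ b ⟧)
    ... | inj₂ (c , e) = contradiction (trans (sym e) eq₁) ⟦⟧≢∞
    ... | inj₁ e with split (f ∞)
    ...   | inj₂ (c , e′) = ⟦⟧-injective (trans (sym e′) eq₂)
    ...   | inj₁ e′       = contradiction (trans (sym eq₂) e′) ⟦⟧≢∞

  fixed-∞ : ∀ {f} → f ∞ ≡ ∞ → ∀ {b} → ¬ Reach f ∞ ⟦ b ⟧
  fixed-∞ {f} fix (k , eq) = ⟦⟧≢∞ (trans (sym eq) (stay k))
    where
    stay : ∀ k → fold ∞ f k ≡ ∞
    stay zero    = refl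
    stay (suc k) = trans (cong f (stay k)) fix

  skip-cyclic : ∀ {f} → Cyclic f → Cyclic (skip f)
  skip-cyclic {f} cyc x y = let k , eq = cyc ⟦ x ⟧ ⟦ y ⟧ in go k x eq
    where
    go : ∀ k x → fold ⟦ x ⟧ f k ≡ ⟦ y ⟧ → Reach (skip f) x y
    go zero x eq = reach-≡ (⟦⟧-injective eq)
    go (suc k) x eq with split (f ⟦ x ⟧)
    ... | inj₂ (c , e) = reach-step (skip-direct e) ⨾
                         go k c (trans (cong (λ z → fold z f k) (sym e)) (fold-unstep f ⟦ x ⟧ k eq))
    go (suc zero) x eq | inj₁ e = contradiction (trans (sym eq) e) ⟦⟧≢∞
    -- The step into `∞` and the step out of it are one step of `skip`, so the recursion drops two.
    go (suc (suc k)) x eq | inj₁ e with split (f ∞)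
    ... | inj₁ e′ = contradiction
          (suc k , trans (cong (λ z → fold z f (suc k)) (sym e)) (fold-unstep f ⟦ x ⟧ (suc k) eq))
          (fixed-∞ {f} e′)
    ... | inj₂ (c , e′) = reach-step (skip-∞ e e′) ⨾
          go k c (trans (cong (λ z → fold z f k) (trans (sym e′) (cong f (sym e))))
                   (fold-unstep f (f ⟦ x ⟧) k (fold-unstep f ⟦ x ⟧ (suc k) eq)))

-- If every orbit of t passes through the image of e, and T is the first return
-- map to it, then t and T have the same orbits.
classes-section : {D X : Set} (t : D → D) (e : X → D) (T : X → X) (fwd : D → X) →
  (∀ x → fwd (e x) ≡ x) →
  (∀ d → fwd (t d) ≡ fwd d ⊎ fwd (t d) ≡ T (fwd d)) →
  (∀ d → Reach t d (e (fwd d))) →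
  (∀ x → Reach t (e x) (e (T x))) →
  (∀ d → ∃[ x ] Reach t (e x) d) →
  ∀ {k} → Classes (Reach T) k → Classes (Reach t) k
classes-section t e T fwd fwd-e fwd-t to-section first-return from-section C = record
  { class      = class ∘ fwd
  ; surjective = λ i → let x , eq = surjective i in e x , trans (cong class (fwd-e x)) eq
  ; class-⇔    = λ d d′ → mk⇔ (reach-invariant (class ∘ fwd) invariant) (same d d′)
  }
  where
  open Classes C
  invariant : ∀ d → class (fwd (t d)) ≡ class (fwd d)
  invariant d with fwd-t d
  ... | inj₁ eq = cong class eq
  ... | inj₂ eq = trans (cong class eq)
        (sym (Equivalence.to (class-⇔ _ _) (reach-step refl)))
  same : ∀ d d′ → class (fwd d) ≡ class (fwd d′) → Reach t d d′
  same d d′ eq with from-section d′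
  ... | x , x↝d′ = to-section d ⨾ reach-lift e first-return d↝x ⨾ x↝d′
    where
    d↝x : Reach T (fwd d) x
    d↝x = Equivalence.from (class-⇔ _ _) (trans eq
      (trans (sym (reach-invariant (class ∘ fwd) invariant x↝d′)) (cong class (fwd-e x))))

-- Embeddings of K_{n,n} from rotations on two arbitrary vertex types.

HamiltonianFace : ℕ → ℕ → Set
HamiltonianFace n g =
  Σ[ E ∈ TwoCellEmbedding (completeBipartite n n) g ]
  Σ[ F ∈ TwoCellEmbedding.Face E ]
  Σ[ C ∈ Cycle (completeBipartite n n) ]
  (Hamiltonian (completeBipartite n n) C × BoundedBy (completeBipartite n n) E F C)

module Embed {n : ℕ} {A B : Set} (A↔ : A ↔ Fin (suc n)) (B↔ : B ↔ Fin (suc n))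
  (rotᴬ : A → B → B) (rotᴮ : B → A → A)
  (rotᴬ-cyclic : ∀ a → Cyclic (rotᴬ a)) (rotᴮ-cyclic : ∀ b → Cyclic (rotᴮ b)) where

  private
    G = completeBipartite (suc n) (suc n)
    V = Graph.Vertex G

  open Inverse A↔ public using () renaming (to to #ᴬ; from to A⟨_⟩)
  open Inverse B↔ public using () renaming (to to #ᴮ; from to B⟨_⟩)

  A⟨#⟩ : ∀ a → A⟨ #ᴬ a ⟩ ≡ a
  A⟨#⟩ = Inverse.strictlyInverseʳ A↔

  B⟨#⟩ : ∀ b → B⟨ #ᴮ b ⟩ ≡ b
  B⟨#⟩ = Inverse.strictlyInverseʳ B↔

  #A⟨⟩ : ∀ i → #ᴬ A⟨ i ⟩ ≡ i
  #A⟨⟩ = Inverse.strictlyInverseˡ A↔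

  #B⟨⟩ : ∀ i → #ᴮ B⟨ i ⟩ ≡ i
  #B⟨⟩ = Inverse.strictlyInverseˡ B↔

  rot : (v : V) → Neighbour G v → Neighbour G v
  rot (inj₁ i) (inj₂ j , _) = inj₂ (#ᴮ (rotᴬ A⟨ i ⟩ B⟨ j ⟩)) , tt
  rot (inj₂ j) (inj₁ i , _) = inj₁ (#ᴬ (rotᴮ B⟨ j ⟩ A⟨ i ⟩)) , tt

  rot-cyclic : ∀ v → Cyclic (rot v)
  rot-cyclic (inj₁ i) = cyclic-conj (λ b → inj₂ (#ᴮ b) , tt) (rotᴬ-cyclic A⟨ i ⟩)
    (λ b → cong (λ b → inj₂ (#ᴮ (rotᴬ A⟨ i ⟩ b)) , tt) (B⟨#⟩ b))
    λ { (inj₁ _ , ()) ; (inj₂ j , _) → B⟨ j ⟩ , cong (λ j → inj₂ j , tt) (#B⟨⟩ j) }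
  rot-cyclic (inj₂ j) = cyclic-conj (λ a → inj₁ (#ᴬ a) , tt) (rotᴮ-cyclic B⟨ j ⟩)
    (λ a → cong (λ a → inj₁ (#ᴬ (rotᴮ B⟨ j ⟩ a)) , tt) (A⟨#⟩ a))
    λ { (inj₂ _ , ()) ; (inj₁ i , _) → A⟨ i ⟩ , cong (λ i → inj₁ i , tt) (#A⟨⟩ i) }

  rotationSystem : RotationSystem G
  rotationSystem = record { rotation = cyclic↔ ∘ rot-cyclic ; cyclic = rot-cyclic }

  open RotationSystem rotationSystem using (traverse; SameFace)

  ab : A → B → Dart G
  ab a b = dart (inj₁ (#ᴬ a)) (inj₂ (#ᴮ b)) tt

  ba : B → A → Dart G
  ba b a = dart (inj₂ (#ᴮ b)) (inj₁ (#ᴬ a)) tt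

  traverse-ab : ∀ a b → traverse (ab a b) ≡ ba b (rotᴮ b a)
  traverse-ab a b = cong₂ (λ b′ a′ → ba b (rotᴮ b′ a′)) (B⟨#⟩ b) (A⟨#⟩ a)

  traverse-ba : ∀ b a → traverse (ba b a) ≡ ab a (rotᴬ a b)
  traverse-ba b a = cong₂ (λ a′ b′ → ab a (rotᴬ a′ b′)) (A⟨#⟩ a) (B⟨#⟩ b)

  data DartView : Dart G → Set where
    ab-view : ∀ a b → DartView (ab a b)
    ba-view : ∀ b a → DartView (ba b a)

  dartView : ∀ d → DartView d
  dartView (dart (inj₁ i) (inj₂ j) _) =
    subst₂ (λ i j → DartView (dart (inj₁ i) (inj₂ j) tt)) (#A⟨⟩ i) (#B⟨⟩ j) (ab-view A⟨ i ⟩ B⟨ j ⟩)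
  dartView (dart (inj₂ j) (inj₁ i) _) =
    subst₂ (λ i j → DartView (dart (inj₂ j) (inj₁ i) tt)) (#A⟨⟩ i) (#B⟨⟩ j) (ba-view B⟨ j ⟩ A⟨ i ⟩)

  onDarts : {X : Set} → (A → B → X) → (B → A → X) → Dart G → X
  onDarts f g (dart (inj₁ i) (inj₂ j) _) = f A⟨ i ⟩ B⟨ j ⟩
  onDarts f g (dart (inj₂ j) (inj₁ i) _) = g B⟨ j ⟩ A⟨ i ⟩

  onDarts-ab : {X : Set} (f : A → B → X) (g : B → A → X) → ∀ a b → onDarts f g (ab a b) ≡ f a b
  onDarts-ab f g a b = cong₂ f (A⟨#⟩ a) (B⟨#⟩ b)

  onDarts-ba : {X : Set} (f : A → B → X) (g : B → A → X) → ∀ b a → onDarts f g (ba b a) ≡ g b a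
  onDarts-ba f g b a = cong₂ g (B⟨#⟩ b) (A⟨#⟩ a)

  connected : Connected G
  connected (inj₁ _) (inj₂ _) = tt ◅ ε
  connected (inj₂ _) (inj₁ _) = tt ◅ ε
  connected (inj₁ _) (inj₁ _) = _◅_ {j = inj₂ zero} tt (tt ◅ ε)
  connected (inj₂ _) (inj₂ _) = _◅_ {j = inj₁ zero} tt (tt ◅ ε)

  edges : Classes (SameEdge G) (suc n * suc n)
  edges = record
    { class      = edge
    ; surjective = λ e → let i , j , eq = Fin.combine-surjective e
                         in dart (inj₁ i) (inj₂ j) tt , eq
    ; class-⇔    = λ d d′ → mk⇔ (same⇒ d d′) (⇒same d d′)
    }
    where
    edge : Dart G → Fin (suc n * suc n)
    edge (dart (inj₁ i) (inj₂ j) _) = combine i j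
    edge (dart (inj₂ j) (inj₁ i) _) = combine i j
    same⇒ : ∀ d d′ → SameEdge G d d′ → edge d ≡ edge d′
    same⇒ d _ (inj₁ refl) = refl
    same⇒ (dart (inj₁ _) (inj₂ _) _) _ (inj₂ refl) = refl
    same⇒ (dart (inj₂ _) (inj₁ _) _) _ (inj₂ refl) = refl
    ⇒same : ∀ d d′ → edge d ≡ edge d′ → SameEdge G d d′
    ⇒same (dart (inj₁ i) (inj₂ j) _) (dart (inj₁ k) (inj₂ l) _) eq
      with refl , refl ← Fin.combine-injective i j k l eq = inj₁ refl
    ⇒same (dart (inj₁ i) (inj₂ j) _) (dart (inj₂ l) (inj₁ k) _) eq
      with refl , refl ← Fin.combine-injective i j k l eq = inj₂ refl
    ⇒same (dart (inj₂ j) (inj₁ i) _) (dart (inj₁ k) (inj₂ l) _) eq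
      with refl , refl ← Fin.combine-injective i j k l eq = inj₂ refl
    ⇒same (dart (inj₂ j) (inj₁ i) _) (dart (inj₂ l) (inj₁ k) _) eq
      with refl , refl ← Fin.combine-injective i j k l eq = inj₁ refl

  module _ {#f g : ℕ} (faces : Classes SameFace #f)
    (euler : (suc n + suc n) + #f + 2 * g ≡ suc n * suc n + 2)
    (2≤n+1 : 2 ≤ suc n)
    (d₀ : Dart G)
    (d₀-period : fold d₀ traverse (suc n + suc n) ≡ d₀)
    (d₀-spans : ∀ v → ∃[ k ] Dart.tail (fold d₀ traverse k) ≡ v) where

    private
      N = suc n + suc n

      embedding : TwoCellEmbedding G g
      embedding = record
        { connected = connected ; rotationSystem = rotationSystem
        ; vertices = ↔-sym Fin.+↔⊎ ; edges = edges ; faces = faces ; euler = euler }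

      walk : ℕ → V
      walk k = Dart.tail (fold d₀ traverse k)

      #ⱽ : V → Fin N
      #ⱽ = Inverse.from Fin.+↔⊎

      walk-onto : ∀ j → ∃[ i ] #ⱽ (walk (toℕ i)) ≡ j
      walk-onto j =
        let k , eq = d₀-spans (Inverse.to (Fin.+↔⊎ {suc n}) j)
        in fromℕ< (m%n<n k N) , (begin
          #ⱽ (walk (toℕ (fromℕ< (m%n<n k N))))  ≡⟨ cong (#ⱽ ∘ walk) (Fin.toℕ-fromℕ< (m%n<n k N)) ⟩
          #ⱽ (walk (k % N))                      ≡⟨ cong (#ⱽ ∘ Dart.tail) (fold-reduce traverse d₀ N d₀-period k) ⟨
          #ⱽ (walk k)                            ≡⟨ cong #ⱽ eq ⟩
          #ⱽ (Inverse.to (Fin.+↔⊎ {suc n}) j)    ≡⟨ Inverse.strictlyInverseʳ (Fin.+↔⊎ {suc n}) j ⟩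
          j                                      ∎)
        where open ≡-Reasoning

      -- A closed walk with N steps that visits all N vertices has no repetition: on one period it
      -- is a surjection between sets of size N.
      walk-distinct : ∀ {i j} → i < N → j < N → walk i ≡ walk j → i ≡ j
      walk-distinct {i} {j} i<N j<N eq = begin
        i                   ≡⟨ Fin.toℕ-fromℕ< i<N ⟨
        toℕ (fromℕ< i<N)    ≡⟨ cong toℕ (surjection-injective (#ⱽ ∘ walk ∘ toℕ) walk-onto (begin
          #ⱽ (walk (toℕ (fromℕ< i<N))) ≡⟨ cong (#ⱽ ∘ walk) (Fin.toℕ-fromℕ< i<N) ⟩
          #ⱽ (walk i)                  ≡⟨ cong #ⱽ eq ⟩
          #ⱽ (walk j)                  ≡⟨ cong (#ⱽ ∘ walk) (Fin.toℕ-fromℕ< j<N) ⟨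
          #ⱽ (walk (toℕ (fromℕ< j<N))) ∎)) ⟩
        toℕ (fromℕ< j<N)    ≡⟨ Fin.toℕ-fromℕ< j<N ⟩
        j                   ∎
        where open ≡-Reasoning

      traverse-adjacent : ∀ d → Graph.Adj G (Dart.tail d) (Dart.tail (traverse d))
      traverse-adjacent (dart (inj₁ _) (inj₂ _) _) = tt
      traverse-adjacent (dart (inj₂ _) (inj₁ _) _) = tt

      cycle : Cycle G
      cycle = record
        { length   = N
        ; 3≤length = ℕ.≤-trans (s≤s (s≤s (s≤s z≤n))) (ℕ.+-mono-≤ 2≤n+1 2≤n+1)
        ; vertex   = walk
        ; periodic = λ i → cong Dart.tail (trans (fold-+ d₀ traverse i)
                                                 (cong (λ d → fold d traverse i) d₀-period))
        ; adjacent = λ i → traverse-adjacent (fold d₀ traverse i)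
        ; distinct = walk-distinct
        }

    hamiltonianFace : HamiltonianFace (suc n) g
    hamiltonianFace = embedding , Classes.class faces d₀ , cycle , d₀-spans , d₀ , refl , λ _ → refl

-- The case n = 4, by finite checks.

-- The rotations were found by computer search.
module K₄₄ where

  table : {A : Set} {m n : ℕ} → Vec (Vec A n) m → Fin m → Fin n → A
  table t i j = lookup (lookup t i) j

  rotᴬ rotᴮ : Fin 4 → Fin 4 → Fin 4
  rotᴬ = table ((2F ∷ 0F ∷ 3F ∷ 1F ∷ []) ∷ (1F ∷ 3F ∷ 0F ∷ 2F ∷ []) ∷
                (1F ∷ 2F ∷ 3F ∷ 0F ∷ []) ∷ (3F ∷ 0F ∷ 1F ∷ 2F ∷ []) ∷ [])
  rotᴮ = table ((1F ∷ 3F ∷ 0F ∷ 2F ∷ []) ∷ (2F ∷ 0F ∷ 3F ∷ 1F ∷ []) ∷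
                (3F ∷ 0F ∷ 1F ∷ 2F ∷ []) ∷ (1F ∷ 2F ∷ 3F ∷ 0F ∷ []) ∷ [])

  reachable? : {A : Set} (_≟ᴬ_ : (x y : A) → Dec (x ≡ y)) (N : ℕ) (f : A → A) (x y : A) →
               Dec (∃[ k ] fold x f (toℕ {N} k) ≡ y)
  reachable? _≟ᴬ_ N f x y = Fin.any? λ k → fold x f (toℕ k) ≟ᴬ y

  bounded : {A : Set} {N : ℕ} {f : A → A} {x y : A} → ∃[ k ] fold x f (toℕ {N} k) ≡ y → Reach f x y
  bounded (k , eq) = toℕ k , eq

  cyclic? : (rot : Fin 4 → Fin 4 → Fin 4) →
            Dec (∀ v x y → ∃[ k ] fold x (rot v) (toℕ {4} k) ≡ y)
  cyclic? rot = Fin.all? λ v → Fin.all? λ x → Fin.all? λ y → reachable? _≟_ 4 (rot v) x y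

  open Embed (↔-id _) (↔-id _) rotᴬ rotᴮ
    (λ a x y → bounded (from-yes (cyclic? rotᴬ) a x y))
    (λ b x y → bounded (from-yes (cyclic? rotᴮ) b x y))

  G = completeBipartite 4 4

  open RotationSystem rotationSystem using (traverse; SameFace)

  -- The two tables number the faces of the darts from the first side to the second and back. Faces
  -- 1 and 2 have eight darts, the others four.
  face : Dart G → Fin 6
  face = onDarts
    (table ((0F ∷ 1F ∷ 2F ∷ 3F ∷ []) ∷ (1F ∷ 0F ∷ 3F ∷ 2F ∷ []) ∷
            (2F ∷ 4F ∷ 1F ∷ 5F ∷ []) ∷ (4F ∷ 2F ∷ 5F ∷ 1F ∷ []) ∷ []))
    (table ((2F ∷ 0F ∷ 4F ∷ 1F ∷ []) ∷ (0F ∷ 2F ∷ 1F ∷ 4F ∷ []) ∷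
            (3F ∷ 1F ∷ 5F ∷ 2F ∷ []) ∷ (1F ∷ 3F ∷ 2F ∷ 5F ∷ []) ∷ []))

  start : Fin 6 → Dart G
  start = lookup (ab 0F 0F ∷ ab 0F 1F ∷ ab 0F 2F ∷ ab 0F 3F ∷ ab 2F 1F ∷ ab 2F 3F ∷ [])

  _≟ᴰ_ : (d d′ : Dart G) → Dec (d ≡ d′)
  dart (inj₁ i) (inj₂ j) _ ≟ᴰ dart (inj₁ k) (inj₂ l) _ with i ≟ k | j ≟ l
  ... | yes refl | yes refl = yes refl
  ... | no  i≢k  | _        = no λ { refl → i≢k refl }
  ... | yes _    | no  j≢l  = no λ { refl → j≢l refl }
  dart (inj₁ i) (inj₂ j) _ ≟ᴰ dart (inj₂ k) (inj₁ l) _ = no λ ()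
  dart (inj₂ i) (inj₁ j) _ ≟ᴰ dart (inj₁ k) (inj₂ l) _ = no λ ()
  dart (inj₂ i) (inj₁ j) _ ≟ᴰ dart (inj₂ k) (inj₁ l) _ with i ≟ k | j ≟ l
  ... | yes refl | yes refl = yes refl
  ... | no  i≢k  | _        = no λ { refl → i≢k refl }
  ... | yes _    | no  j≢l  = no λ { refl → j≢l refl }

  allDarts? : {P : Dart G → Set} → (∀ d → Dec (P d)) → Dec (∀ d → P d)
  allDarts? P? = map′
    (λ { (p , q) (dart (inj₁ i) (inj₂ j) _) → p i j ; (p , q) (dart (inj₂ j) (inj₁ i) _) → q j i })
    (λ p → (λ i j → p (ab i j)) , (λ j i → p (ba j i)))
    (Fin.all? (λ i → Fin.all? λ j → P? (ab i j)) ×-dec Fin.all? (λ j → Fin.all? λ i → P? (ba j i)))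

  -- The section has one dart per face, so its return map is the identity; 8 is the length of the
  -- longest face.
  faces : Classes SameFace 6
  faces = classes-section traverse start id face
    (from-yes (Fin.all? λ i → face (start i) ≟ i))
    (λ d → inj₁ (from-yes (allDarts? λ d → face (traverse d) ≟ face d) d))
    (λ d → bounded (from-yes (allDarts? λ d → reachable? _≟ᴰ_ 8 traverse d (start (face d))) d))
    (λ _ → reach-refl)
    (λ d → face d , bounded (from-yes (allDarts? λ d → reachable? _≟ᴰ_ 8 traverse (start (face d)) d) d))
    (record { class = id ; surjective = λ i → i , refl
            ; class-⇔ = λ i j → mk⇔ (reach-invariant id λ _ → refl) reach-≡ })

  hamiltonianFace₄ : HamiltonianFace 4 2
  hamiltonianFace₄ = hamiltonianFace faces refl (s≤s (s≤s z≤n)) (ab 0F 1F) refl λ where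
    (inj₁ 0F) → 0 , refl
    (inj₂ 1F) → 1 , refl
    (inj₁ 2F) → 2 , refl
    (inj₂ 2F) → 3 , refl
    (inj₁ 1F) → 4 , refl
    (inj₂ 0F) → 5 , refl
    (inj₁ 3F) → 6 , refl
    (inj₂ 3F) → 7 , refl

-- From a gluing of polygons to a Hamiltonian face.

-- The rotation system of K_{n,n} obtained from a gluing of white and black
-- polygons, by deletion of the vertex ∞.  The white polygon i has the
-- vertices V in the cyclic order nextᵂ i, the black polygon k in the cyclic
-- order nextᴷ k; the arc of i out of v is glued to the arc of (out v i) out of v,
-- the arc of k into v to the arc of (back v k) into v.  Polygons are the vertices
-- of one side of K_{n,n}, and each glued pair of arcs is a quadrilateral.
record Gluing (I J V B : Set) : Set where
  field
    ∞             : V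
    ⟦_⟧           : B → V
    decode        : V → Maybe B
    decode-∞      : decode ∞ ≡ nothing
    decode-⟦⟧     : ∀ b → decode ⟦ b ⟧ ≡ just b
    split         : ∀ v → v ≡ ∞ ⊎ ∃[ b ] v ≡ ⟦ b ⟧
    nextᵂ         : I → V → V
    nextᴷ         : J → V → V
    nextᵂ-cyclic  : ∀ i → Cyclic (nextᵂ i)
    nextᴷ-cyclic  : ∀ k → Cyclic (nextᴷ k)
    out           : V → I → J
    back          : V → J → I
    turn-cyclic   : ∀ v → Cyclic (λ i → back v (out v i))
    out-onto      : ∀ v k → ∃[ i ] out v i ≡ k
    -- twist is the identity except where two quadrilaterals are merged.
    twist         : V → I → I
    quad          : ∀ v i → back (nextᴷ (out v i) v) (out v i) ≡ twist v i ×
                            nextᵂ (twist v i) v ≡ nextᴷ (out v i) v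
    -- The deletion of `∞` has to join quadrilaterals only: twisted arcs neither start nor end at
    -- `∞`.
    twist-∞       : ∀ i → twist ∞ i ≡ i
    twist-before-∞ : ∀ v → (∀ i → twist v i ≡ i) ⊎ (∀ i → nextᵂ i v ≢ ∞)
    -- A face at `∞` comes from an arc into `∞` or out of it, and its fourth vertex is the other
    -- end. There are as many such faces as vertices besides `∞`, so meeting every vertex is the
    -- same as distinctness.
    spans         : ∀ b → (∃[ i ] nextᵂ i ⟦ b ⟧ ≡ ∞) ⊎ (∃[ k ] nextᴷ k ∞ ≡ ⟦ b ⟧)

  ⟦⟧-injective : ∀ {b c} → ⟦ b ⟧ ≡ ⟦ c ⟧ → b ≡ c
  ⟦⟧-injective {b} {c} eq =
    just-injective (trans (sym (decode-⟦⟧ b)) (trans (cong decode eq) (decode-⟦⟧ c)))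

  ⟦⟧≢∞ : ∀ {b} → ⟦ b ⟧ ≢ ∞
  ⟦⟧≢∞ {b} eq with () ← trans (sym (decode-⟦⟧ b)) (trans (cong decode eq) decode-∞)

-- The quotient that identifies q with p; it counts the faces when two quadrilaterals unite in an
-- octagon.
merge : ∀ {k} {p q : Fin (suc k)} → q ≢ p → Fin (suc k) → Fin k
merge {q = q} q≢p i with q ≟ i
... | yes _  = punchOut q≢p
... | no q≢i = punchOut q≢i

merge-onto : ∀ {k} {p q : Fin (suc k)} (q≢p : q ≢ p) (j : Fin k) → ∃[ i ] merge q≢p i ≡ j
merge-onto {q = q} q≢p j = punchIn q j , eq
  where
  eq : merge q≢p (punchIn q j) ≡ j
  eq with q ≟ punchIn q j
  ... | yes e = contradiction (sym e) (Fin.punchInᵢ≢i q j)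
  ... | no  _ = trans (Fin.punchOut-cong q refl) (Fin.punchOut-punchIn q)

merge-q : ∀ {k} {p q : Fin (suc k)} (q≢p : q ≢ p) → merge q≢p p ≡ merge q≢p q
merge-q {p = p} {q} q≢p with q ≟ p | q ≟ q
... | yes e | _     = contradiction e q≢p
... | no _  | yes _ = Fin.punchOut-cong q refl
... | no _  | no ne = contradiction refl ne

merge-fibre : ∀ {k} {p q : Fin (suc k)} (q≢p : q ≢ p) {i j} → merge q≢p i ≡ merge q≢p j →
              i ≡ j ⊎ (i ≡ q × j ≡ p) ⊎ (i ≡ p × j ≡ q)
merge-fibre {p = p} {q} q≢p {i} {j} eq with q ≟ i | q ≟ j
... | yes refl | yes refl = inj₁ refl
... | yes refl | no  q≢j  = inj₂ (inj₁ (refl , sym (Fin.punchOut-injective q≢p q≢j eq)))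
... | no  q≢i  | yes refl = inj₂ (inj₂ (Fin.punchOut-injective q≢i q≢p eq , refl))
... | no  q≢i  | no  q≢j  = inj₁ (Fin.punchOut-injective q≢i q≢j eq)

2≤double : ∀ m {n} → m + m ≡ suc n → 2 ≤ suc n
2≤double (suc m) eq = subst (2 ≤_) eq (s≤s (ℕ.m≤n⇒m≤o+n m (s≤s z≤n)))

module Assemble {m n : ℕ} {I J V B : Set} (Γ : Gluing I J V B)
  (I↔ : I ↔ Fin m) (J↔ : J ↔ Fin m) (B↔ : B ↔ Fin (suc n))
  (m+m≡n+1 : m + m ≡ suc n) (i₀ : I) where

  open Gluing Γ
  open Deletion ∞ ⟦_⟧ ⟦⟧-injective ⟦⟧≢∞ split

  -- White orders are inverted: a face that follows an arc in its black polygon has to come back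
  -- along the glued arc of the white one.
  rotᴬ : I ⊎ J → B → B
  rotᴬ (inj₁ i) = inverse (skip-cyclic (nextᵂ-cyclic i))
  rotᴬ (inj₂ k) = skip (nextᴷ k)

  rotᴮ : B → I ⊎ J → I ⊎ J
  rotᴮ b (inj₁ i) = inj₂ (out ⟦ b ⟧ i)
  rotᴮ b (inj₂ k) = inj₁ (back ⟦ b ⟧ k)

  rotᴬ-cyclic : ∀ a → Cyclic (rotᴬ a)
  rotᴬ-cyclic (inj₁ i) = inverse-cyclic (skip-cyclic (nextᵂ-cyclic i))
  rotᴬ-cyclic (inj₂ k) = skip-cyclic (nextᴷ-cyclic k)

  rotᴮ-cyclic : ∀ b → Cyclic (rotᴮ b)
  rotᴮ-cyclic b = cyclic-lift inj₁ (turn-cyclic ⟦ b ⟧) (λ _ → 2 , refl)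
    (λ { (inj₁ i) → i , reach-refl
       ; (inj₂ k) → let i , eq = out-onto ⟦ b ⟧ k in i , reach-step (cong inj₂ eq) })
    (λ { (inj₁ i) → i , reach-refl
       ; (inj₂ k) → back ⟦ b ⟧ k , reach-step refl })

  rotᴬ-white : ∀ {i b c} → skip (nextᵂ i) b ≡ c → rotᴬ (inj₁ i) c ≡ b
  rotᴬ-white {i} eq = inverse-unique (skip-cyclic (nextᵂ-cyclic i)) eq

  A↔ : (I ⊎ J) ↔ Fin (suc n)
  A↔ = subst (λ l → (I ⊎ J) ↔ Fin l) m+m≡n+1 (↔-sym Fin.+↔⊎ ↔-∘ (I↔ ⊎-↔ J↔))

  open Embed A↔ B↔ rotᴬ rotᴮ rotᴬ-cyclic rotᴮ-cyclic public
  open RotationSystem rotationSystem using (traverse; SameFace)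

  corner : I × B → Dart (completeBipartite (suc n) (suc n))
  corner (i , b) = ab (inj₁ i) b

  -- The darts of a face leave, in turn, a white polygon, a vertex, a black polygon and a vertex.
  -- Those that leave a white polygon are the corners; this is the first corner at or after the
  -- given dart.
  forwardᴬᴮ : I ⊎ J → B → I × B
  forwardᴬᴮ (inj₁ i) b = i , b
  forwardᴬᴮ (inj₂ k) b = back ⟦ b ⟧ k , rotᴬ (inj₁ (back ⟦ b ⟧ k)) b

  forwardᴮᴬ : B → I ⊎ J → I × B
  forwardᴮᴬ b a = forwardᴬᴮ a (rotᴬ a b)

  forward : Dart (completeBipartite (suc n) (suc n)) → I × B
  forward = onDarts forwardᴬᴮ forwardᴮᴬ

  -- The corner four darts later, that is, the first return to the corners.
  turn : I × B → I × B
  turn (i , b) = forwardᴮᴬ b (inj₂ (out ⟦ b ⟧ i))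

  private
    fwd-ab = onDarts-ab forwardᴬᴮ forwardᴮᴬ
    fwd-ba = onDarts-ba forwardᴬᴮ forwardᴮᴬ

  turn-traverse : ∀ x → fold (corner x) traverse 4 ≡ corner (turn x)
  turn-traverse (i , b) = begin
    traverse (traverse (traverse (traverse (ab (inj₁ i) b)))) ≡⟨ cong (traverse ∘ traverse ∘ traverse) (traverse-ab _ b) ⟩
    traverse (traverse (traverse (ba b (inj₂ k))))            ≡⟨ cong (traverse ∘ traverse) (traverse-ba b _) ⟩
    traverse (traverse (ab (inj₂ k) c))                       ≡⟨ cong traverse (traverse-ab _ c) ⟩
    traverse (ba c (inj₁ (back ⟦ c ⟧ k)))                     ≡⟨ traverse-ba c _ ⟩
    corner (turn (i , b))                                     ∎
    where
    open ≡-Reasoning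
    k = out ⟦ b ⟧ i
    c = rotᴬ (inj₂ k) b

  forward-traverse : ∀ d → forward (traverse d) ≡ forward d ⊎ forward (traverse d) ≡ turn (forward d)
  forward-traverse d with dartView d
  ... | ab-view (inj₁ i) b = inj₂ (trans (cong forward (traverse-ab _ b))
          (trans (fwd-ba b _) (cong turn (sym (fwd-ab (inj₁ i) b)))))
  ... | ab-view (inj₂ k) b = inj₁ (trans (cong forward (traverse-ab _ b))
          (trans (fwd-ba b _) (sym (fwd-ab (inj₂ k) b))))
  ... | ba-view b a        = inj₁ (trans (cong forward (traverse-ba b a))
          (trans (fwd-ab a _) (sym (fwd-ba b a))))

  to-cornerᴬᴮ : ∀ a b → Reach traverse (ab a b) (corner (forwardᴬᴮ a b))
  to-cornerᴬᴮ (inj₁ i) b = reach-refl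
  to-cornerᴬᴮ (inj₂ k) b = reach-step (traverse-ab _ b) ⨾ reach-step (traverse-ba b _)

  to-corner : ∀ d → Reach traverse d (corner (forward d))
  to-corner d with dartView d
  ... | ab-view a b = subst (Reach traverse (ab a b) ∘ corner) (sym (fwd-ab a b)) (to-cornerᴬᴮ a b)
  ... | ba-view b a = reach-step (traverse-ba b a) ⨾
          subst (Reach traverse (ab a (rotᴬ a b)) ∘ corner) (sym (fwd-ba b a)) (to-cornerᴬᴮ a (rotᴬ a b))

  from-cornerᴮᴷ : ∀ b k → ∃[ x ] Reach traverse (corner x) (ba b (inj₂ k))
  from-cornerᴮᴷ b k = let i , eq = out-onto ⟦ b ⟧ k in
    (i , b) , reach-step (trans (traverse-ab _ b) (cong (λ k → ba b (inj₂ k)) eq))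

  from-cornerᴷᴮ : ∀ k c → ∃[ x ] Reach traverse (corner x) (ab (inj₂ k) c)
  from-cornerᴷᴮ k c =
    let x , reach = from-cornerᴮᴷ (inverse (skip-cyclic (nextᴷ-cyclic k)) c) k
    in x , reach ⨾ reach-step (trans (traverse-ba _ (inj₂ k))
                     (cong (ab (inj₂ k)) (inverseʳ (skip-cyclic (nextᴷ-cyclic k)) c)))

  from-corner : ∀ d → ∃[ x ] Reach traverse (corner x) d
  from-corner d with dartView d
  ... | ab-view (inj₁ i) b = (i , b) , reach-refl
  ... | ba-view b (inj₂ k) = from-cornerᴮᴷ b k
  ... | ab-view (inj₂ k) c = from-cornerᴷᴮ k c
  ... | ba-view c (inj₁ i) =
    let x , reach = from-cornerᴷᴮ (out ⟦ c ⟧ (inverse (turn-cyclic ⟦ c ⟧) i)) c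
    in x , reach ⨾ reach-step (trans (traverse-ab _ c)
                     (cong (λ i → ba c (inj₁ i)) (inverseʳ (turn-cyclic ⟦ c ⟧) i)))

  facesFromTurns : ∀ {k} → Classes (Reach turn) k → Classes SameFace k
  facesFromTurns = classes-section traverse corner turn forward
    (λ (i , b) → fwd-ab (inj₁ i) b) forward-traverse to-corner (λ x → 4 , turn-traverse x) from-corner

  last : I → B
  last i with split (inverse (nextᵂ-cyclic i) ∞)
  ... | inj₂ (b , _) = b
  -- A default: `∞` would precede itself, which `next-last` excludes.
  ... | inj₁ _       = Inverse.from B↔ zero

  next-last : ∀ i → nextᵂ i ⟦ last i ⟧ ≡ ∞
  next-last i with split (inverse (nextᵂ-cyclic i) ∞)
  ... | inj₂ (b , eq) = trans (cong (nextᵂ i) (sym eq)) (inverseʳ (nextᵂ-cyclic i) ∞)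
  ... | inj₁ eq = contradiction (nextᵂ-cyclic i ∞ ⟦ Inverse.from B↔ zero ⟧)
          (fixed-∞ {nextᵂ i} (trans (cong (nextᵂ i) (sym eq)) (inverseʳ (nextᵂ-cyclic i) ∞)))

  last-unique : ∀ {i b} → nextᵂ i ⟦ b ⟧ ≡ ∞ → b ≡ last i
  last-unique {i} eq = ⟦⟧-injective (cyclic-injective (nextᵂ-cyclic i) (trans eq (sym (next-last i))))

  twist-last : ∀ i → twist ⟦ last i ⟧ i ≡ i
  twist-last i with twist-before-∞ ⟦ last i ⟧
  ... | inj₁ id≗ = id≗ i
  ... | inj₂ ≢∞  = contradiction (next-last i) (≢∞ i)

  black-∞ : I → J
  black-∞ i = out ⟦ last i ⟧ i

  nextᴷ-last : ∀ i → nextᴷ (black-∞ i) ⟦ last i ⟧ ≡ ∞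
  nextᴷ-last i = trans (sym (proj₂ (quad ⟦ last i ⟧ i)))
    (trans (cong (λ j → nextᵂ j ⟦ last i ⟧) (twist-last i)) (next-last i))

  -- The white polygon that follows `i` on the boundary of the Hamiltonian face. As this face
  -- surrounds `∞` from outside, `σ` inverts the rotation at `∞`.
  σ : I → I
  σ i = proj₁ (out-onto ∞ (black-∞ i))

  out-∞-σ : ∀ i → out ∞ (σ i) ≡ black-∞ i
  out-∞-σ i = proj₂ (out-onto ∞ (black-∞ i))

  σ-cyclic : Cyclic σ
  σ-cyclic = cyclic-rightInverse (turn-cyclic ∞) λ i → begin
    back ∞ (out ∞ (σ i))                                   ≡⟨ cong (back ∞) (out-∞-σ i) ⟩
    back ∞ (black-∞ i)                                     ≡⟨ cong (λ c → back c (black-∞ i)) (nextᴷ-last i) ⟨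
    back (nextᴷ (black-∞ i) ⟦ last i ⟧) (black-∞ i)        ≡⟨ proj₁ (quad ⟦ last i ⟧ i) ⟩
    twist ⟦ last i ⟧ i                                     ≡⟨ twist-last i ⟩
    i                                                      ∎
    where open ≡-Reasoning

  turn-≡ : ∀ {i j b b′ c} → nextᴷ (out ⟦ b ⟧ i) ⟦ b ⟧ ≡ ⟦ c ⟧ ⊎
             (nextᴷ (out ⟦ b ⟧ i) ⟦ b ⟧ ≡ ∞ × nextᴷ (out ⟦ b ⟧ i) ∞ ≡ ⟦ c ⟧) →
           back ⟦ c ⟧ (out ⟦ b ⟧ i) ≡ j → skip (nextᵂ j) b′ ≡ c → turn (i , b) ≡ (j , b′)
  turn-≡ {i} {j} {b} {b′} {c} next≡ back≡ prev≡ = begin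
    forwardᴬᴮ (inj₂ k) (skip (nextᴷ k) b) ≡⟨ cong (forwardᴬᴮ (inj₂ k)) (skip≡ next≡) ⟩
    forwardᴬᴮ (inj₂ k) c                  ≡⟨ cong (λ i → i , rotᴬ (inj₁ i) c) back≡ ⟩
    j , rotᴬ (inj₁ j) c                   ≡⟨ cong (j ,_) (rotᴬ-white prev≡) ⟩
    j , b′                                ∎
    where
    open ≡-Reasoning
    k = out ⟦ b ⟧ i
    skip≡ : nextᴷ k ⟦ b ⟧ ≡ ⟦ c ⟧ ⊎ (nextᴷ k ⟦ b ⟧ ≡ ∞ × nextᴷ k ∞ ≡ ⟦ c ⟧) → skip (nextᴷ k) b ≡ c
    skip≡ (inj₁ e)         = skip-direct e
    skip≡ (inj₂ (e₁ , e₂)) = skip-∞ e₁ e₂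

  -- The arc does not end at `∞`, so the deletion leaves its quadrilateral, or octagon, as it was.
  turn-quad : ∀ {i b} → b ≢ last i → turn (i , b) ≡ (twist ⟦ b ⟧ i , b)
  turn-quad {i} {b} b≢last with split (nextᴷ (out ⟦ b ⟧ i) ⟦ b ⟧) | quad ⟦ b ⟧ i
  ... | inj₂ (c , eq) | back≡ , next≡ = turn-≡ (inj₁ eq)
    (trans (cong (λ v → back v (out ⟦ b ⟧ i)) (sym eq)) back≡)
    (skip-direct (trans next≡ eq))
  ... | inj₁ eq | back≡ , next≡ with twist-before-∞ ⟦ b ⟧
  ...   | inj₁ id≗ = contradiction
          (last-unique (trans (cong (λ j → nextᵂ j ⟦ b ⟧) (sym (id≗ i))) (trans next≡ eq))) b≢last
  ...   | inj₂ ≢∞  = contradiction (trans next≡ eq) (≢∞ _)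

  -- Two quadrilaterals at `∞` are run through in succession: the black polygon jumps over `∞` to
  -- its next vertex, and the white polygon `σ i`, read backwards from there, jumps over `∞` to
  -- `last (σ i)`.
  turn-last : ∀ i → turn (i , last i) ≡ (σ i , last (σ i))
  turn-last i with split (nextᴷ (black-∞ i) ∞)
  ... | inj₁ eq = contradiction (nextᴷ-cyclic (black-∞ i) ∞ ⟦ last i ⟧) (fixed-∞ {nextᴷ (black-∞ i)} eq)
  ... | inj₂ (c , eq) with quad ∞ (σ i)
  ...   | back≡ , next≡ = turn-≡ (inj₂ (nextᴷ-last i , eq)) back≡σ (skip-∞ (next-last (σ i)) next≡c)
    where
    next∞≡c : nextᴷ (out ∞ (σ i)) ∞ ≡ ⟦ c ⟧
    next∞≡c = trans (cong (λ k → nextᴷ k ∞) (out-∞-σ i)) eq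
    back≡σ : back ⟦ c ⟧ (black-∞ i) ≡ σ i
    back≡σ = trans (cong₂ back (sym next∞≡c) (sym (out-∞-σ i))) (trans back≡ (twist-∞ (σ i)))
    next≡c : nextᵂ (σ i) ∞ ≡ ⟦ c ⟧
    next≡c = trans (cong (λ j → nextᵂ j ∞) (sym (twist-∞ (σ i)))) (trans next≡ next∞≡c)

  open Inverse I↔ using () renaming (to to #ᴵ)

  -- All corners next to the deleted `∞` share the face `zero`; every other corner has a number of
  -- its own, which is exact when nothing is twisted.
  facet : I × B → Fin (suc (m * n))
  facet (i , b) with #ᴮ (last i) ≟ #ᴮ b
  ... | yes _  = zero
  ... | no ≢ = suc (combine (#ᴵ i) (punchOut ≢))

  #ᴮ-injective : ∀ {b c} → #ᴮ b ≡ #ᴮ c → b ≡ c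
  #ᴮ-injective eq = trans (sym (B⟨#⟩ _)) (trans (cong B⟨_⟩ eq) (B⟨#⟩ _))

  #ᴵ-injective : ∀ {i j} → #ᴵ i ≡ #ᴵ j → i ≡ j
  #ᴵ-injective eq = trans (sym (Inverse.strictlyInverseʳ I↔ _))
    (trans (cong (Inverse.from I↔) eq) (Inverse.strictlyInverseʳ I↔ _))

  facet-last : ∀ i → facet (i , last i) ≡ zero
  facet-last i with #ᴮ (last i) ≟ #ᴮ (last i)
  ... | yes _ = refl
  ... | no ≢  = contradiction refl ≢

  facet-fibre : ∀ {i b j c} → facet (i , b) ≡ facet (j , c) →
                (i , b) ≡ (j , c) ⊎ (b ≡ last i × c ≡ last j)
  facet-fibre {i} {b} {j} {c} eq with #ᴮ (last i) ≟ #ᴮ b | #ᴮ (last j) ≟ #ᴮ c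
  ... | yes e₁ | yes e₂ = inj₂ (#ᴮ-injective (sym e₁) , #ᴮ-injective (sym e₂))
  ... | no ≢₁  | no ≢₂ with Fin.combine-injective _ _ _ _ (Fin.suc-injective eq)
  ...   | i≡j , b≡c with refl ← #ᴵ-injective i≡j =
          inj₁ (cong (i ,_) (#ᴮ-injective (Fin.punchOut-injective ≢₁ ≢₂ b≡c)))

  facet-onto : ∀ f → ∃[ x ] facet x ≡ f
  facet-onto zero = (i₀ , last i₀) , facet-last i₀
  facet-onto (suc f) with Fin.combine-surjective {m} {n} f
  ... | i# , p , refl = (i , b) , eq
    where
    i = Inverse.from I↔ i#
    b = B⟨ punchIn (#ᴮ (last i)) p ⟩
    eq : facet (i , b) ≡ suc (combine i# p)
    eq with #ᴮ (last i) ≟ #ᴮ b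
    ... | yes e = contradiction (trans (sym (#B⟨⟩ _)) (sym e)) (Fin.punchInᵢ≢i (#ᴮ (last i)) p)
    ... | no ≢  = cong suc (cong₂ combine (Inverse.strictlyInverseˡ I↔ i#)
                    (trans (Fin.punchOut-cong (#ᴮ (last i)) {i≢k = Fin.punchInᵢ≢i (#ᴮ (last i)) p ∘ sym} (#B⟨⟩ _))
                           (Fin.punchOut-punchIn (#ᴮ (last i)))))

  last-orbit : ∀ {i j} → Reach turn (i , last i) (j , last j)
  last-orbit {i} {j} = reach-lift (λ i → i , last i) (λ i → reach-step (turn-last i)) (σ-cyclic i j)

  facet-turn : ∀ i b → (∀ j → twist ⟦ b ⟧ j ≡ j) → facet (turn (i , b)) ≡ facet (i , b)
  facet-turn i b id≗ with #ᴮ b ≟ #ᴮ (last i)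
  ... | yes e with refl ← #ᴮ-injective e =
    trans (cong facet (turn-last i)) (trans (facet-last (σ i)) (sym (facet-last i)))
  ... | no ≢ = cong facet (trans (turn-quad (≢ ∘ cong #ᴮ)) (cong (_, b) (id≗ i)))

  turnClasses-untwisted : (∀ v i → twist v i ≡ i) → Classes (Reach turn) (suc (m * n))
  turnClasses-untwisted id≗ = record
    { class = facet ; surjective = facet-onto
    ; class-⇔ = λ (i , b) (j , c) → mk⇔
        (reach-invariant facet (λ (i , b) → facet-turn i b (id≗ ⟦ b ⟧)))
        (same ∘ facet-fibre)
    }
    where
    same : ∀ {i b j c} → (i , b) ≡ (j , c) ⊎ (b ≡ last i × c ≡ last j) → Reach turn (i , b) (j , c)
    same (inj₁ eq)            = reach-≡ eq
    same (inj₂ (refl , refl)) = last-orbit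

  module _ (b₀ : B) (p q : I) (p≢q : p ≢ q) (b₀≢∞ : ∀ i → nextᵂ i ⟦ b₀ ⟧ ≢ ∞)
    (twist-p : twist ⟦ b₀ ⟧ p ≡ q) (twist-q : twist ⟦ b₀ ⟧ q ≡ p)
    (twist-id : ∀ v i → twist v i ≡ i ⊎ (v ≡ ⟦ b₀ ⟧ × (i ≡ p ⊎ i ≡ q))) where

    private
      b₀≢last : ∀ i → b₀ ≢ last i
      b₀≢last i refl = b₀≢∞ i (next-last i)

      q≢p′ : facet (q , b₀) ≢ facet (p , b₀)
      q≢p′ eq with facet-fibre {q} {b₀} {p} {b₀} eq
      ... | inj₁ e       = p≢q (sym (cong proj₁ e))
      ... | inj₂ (e , _) = b₀≢last q e

      class : I × B → Fin (m * n)
      class = merge q≢p′ ∘ facet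

      turn-p : turn (p , b₀) ≡ (q , b₀)
      turn-p = trans (turn-quad (b₀≢last p)) (cong (_, b₀) twist-p)

      turn-q : turn (q , b₀) ≡ (p , b₀)
      turn-q = trans (turn-quad (b₀≢last q)) (cong (_, b₀) twist-q)

      class-turn : ∀ i b → class (turn (i , b)) ≡ class (i , b)
      class-turn i b with #ᴮ b ≟ #ᴮ (last i)
      ... | yes e with refl ← #ᴮ-injective e = cong (merge q≢p′)
        (trans (cong facet (turn-last i)) (trans (facet-last (σ i)) (sym (facet-last i))))
      class-turn i b | no ≢ with twist-id ⟦ b ⟧ i
      ... | inj₁ eq = cong class (trans (turn-quad (≢ ∘ cong #ᴮ)) (cong (_, b) eq))
      ... | inj₂ (e , w) with refl ← ⟦⟧-injective e with w
      ...   | inj₁ refl = trans (cong class turn-p) (sym (merge-q q≢p′))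
      ...   | inj₂ refl = trans (cong class turn-q) (merge-q q≢p′)

      same₀ : ∀ {x y} → facet x ≡ facet y → Reach turn x y
      same₀ eq with facet-fibre eq
      ... | inj₁ e             = reach-≡ e
      ... | inj₂ (refl , refl) = last-orbit

      same : ∀ {x y} → facet x ≡ facet y ⊎ (facet x ≡ facet (q , b₀) × facet y ≡ facet (p , b₀)) ⊎
                       (facet x ≡ facet (p , b₀) × facet y ≡ facet (q , b₀)) → Reach turn x y
      same (inj₁ eq)               = same₀ eq
      same (inj₂ (inj₁ (e₁ , e₂))) = same₀ e₁ ⨾ reach-step turn-q ⨾ same₀ (sym e₂)
      same (inj₂ (inj₂ (e₁ , e₂))) = same₀ e₁ ⨾ reach-step turn-p ⨾ same₀ (sym e₂)

    -- `turn` exchanges the corners of `p` and `q` at `b₀`, so just these two facets unite.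
    turnClasses-twisted : Classes (Reach turn) (m * n)
    turnClasses-twisted = record
      { class = class
      ; surjective = λ j → let f , e = merge-onto q≢p′ j ; x , e′ = facet-onto f
                           in x , trans (cong (merge q≢p′) e′) e
      ; class-⇔ = λ x y → mk⇔ (reach-invariant class (λ (i , b) → class-turn i b))
                              (λ eq → same {x} {y} (merge-fibre q≢p′ eq))
      }

  σ-period : ∀ i → fold i σ m ≡ i
  σ-period i = #ᴵ-injective (trans (transport m) (cyclic-period σ# σ#-cyclic (#ᴵ i)))
    where
    σ# : Fin m → Fin m
    σ# = #ᴵ ∘ σ ∘ Inverse.from I↔
    commute : ∀ i → σ# (#ᴵ i) ≡ #ᴵ (σ i)
    commute i = cong (#ᴵ ∘ σ) (Inverse.strictlyInverseʳ I↔ i)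
    σ#-cyclic : Cyclic σ#
    σ#-cyclic = cyclic-conj #ᴵ σ-cyclic commute
      (λ j → Inverse.from I↔ j , Inverse.strictlyInverseˡ I↔ j)
    transport : ∀ k → #ᴵ (fold i σ k) ≡ fold (#ᴵ i) σ# k
    transport zero    = refl
    transport (suc k) = trans (sym (commute _)) (cong σ# (transport k))

  d₀ : Dart (completeBipartite (suc n) (suc n))
  d₀ = corner (i₀ , last i₀)

  traverse-last : ∀ k i → fold (corner (i , last i)) traverse (k * 4) ≡
                          corner (fold i σ k , last (fold i σ k))
  traverse-last zero    i = refl
  traverse-last (suc k) i = begin
    fold (corner (i , last i)) traverse (4 + k * 4)                    ≡⟨ fold-+ (corner (i , last i)) traverse 4 {k * 4} ⟩
    fold (fold (corner (i , last i)) traverse (k * 4)) traverse 4      ≡⟨ cong (λ d → fold d traverse 4) (traverse-last k i) ⟩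
    fold (corner (j , last j)) traverse 4                              ≡⟨ turn-traverse (j , last j) ⟩
    corner (turn (j , last j))                                         ≡⟨ cong corner (turn-last j) ⟩
    corner (σ j , last (σ j))                                          ∎
    where
    open ≡-Reasoning
    j = fold i σ k

  d₀-period : fold d₀ traverse (suc n + suc n) ≡ d₀
  d₀-period = begin
    fold d₀ traverse (suc n + suc n)  ≡⟨ cong (fold d₀ traverse) length≡ ⟩
    fold d₀ traverse (m * 4)          ≡⟨ traverse-last m i₀ ⟩
    corner (fold i₀ σ m , last (fold i₀ σ m)) ≡⟨ cong (λ i → corner (i , last i)) (σ-period i₀) ⟩
    d₀                                ∎
    where
    open ≡-Reasoning
    length≡ : suc n + suc n ≡ m * 4
    length≡ = begin
      suc n + suc n        ≡⟨ cong (λ l → l + l) m+m≡n+1 ⟨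
      (m + m) + (m + m)    ≡⟨ solve 1 (λ m → (m :+ m) :+ (m :+ m) := m :* con 4) refl m ⟩
      m * 4                ∎
      where open import Data.Nat.Solver using (module +-*-Solver)
            open +-*-Solver

  reach-last : ∀ i → Reach traverse d₀ (corner (i , last i))
  reach-last i = reach-lift corner (λ x → 4 , turn-traverse x) last-orbit

  visit : ∀ {d} {v : Fin (suc n) ⊎ Fin (suc n)} → Reach traverse d₀ d → Dart.tail d ≡ v →
          ∃[ k ] Dart.tail (fold d₀ traverse k) ≡ v
  visit (k , refl) eq = k , eq

  black-∞-onto : ∀ k → ∃[ i ] black-∞ i ≡ k
  black-∞-onto k with out-onto ∞ k
  ... | j , eq = inverse σ-cyclic j ,
    trans (sym (out-∞-σ _)) (trans (cong (out ∞) (inverseʳ σ-cyclic j)) eq)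

  reach-black : ∀ i → Reach traverse d₀ (ba (last i) (inj₂ (black-∞ i)))
  reach-black i = reach-last i ⨾ reach-step (traverse-ab _ (last i))

  visitᴬ : ∀ a → ∃[ k ] Dart.tail (fold d₀ traverse k) ≡ inj₁ (#ᴬ a)
  visitᴬ (inj₁ i) = visit (reach-last i) refl
  visitᴬ (inj₂ k) with black-∞-onto k
  ... | i , refl = visit (reach-black i ⨾ reach-step (traverse-ba _ (inj₂ (black-∞ i)))) refl

  -- The boundary walk meets the white predecessors and the black successors of `∞`; by `spans`
  -- these are all vertices.
  visitᴮ : ∀ b → ∃[ k ] Dart.tail (fold d₀ traverse k) ≡ inj₂ (#ᴮ b)
  visitᴮ b with spans b
  ... | inj₁ (i , eq) with refl ← last-unique eq = visit (reach-black i) refl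
  ... | inj₂ (k , eq) with black-∞-onto k
  ...   | i , refl = visit
    (reach-black i ⨾ reach-step (traverse-ba _ (inj₂ (black-∞ i))) ⨾ reach-step (traverse-ab _ _))
    (cong (inj₂ ∘ #ᴮ) (skip-∞ (nextᴷ-last i) eq))

  d₀-spans : ∀ v → ∃[ k ] Dart.tail (fold d₀ traverse k) ≡ v
  d₀-spans (inj₁ i) = subst (λ i → ∃[ k ] Dart.tail (fold d₀ traverse k) ≡ inj₁ i) (#A⟨⟩ i) (visitᴬ A⟨ i ⟩)
  d₀-spans (inj₂ j) = subst (λ j → ∃[ k ] Dart.tail (fold d₀ traverse k) ≡ inj₂ j) (#B⟨⟩ j) (visitᴮ B⟨ j ⟩)

  hamiltonianFace-of : ∀ {k g} → Classes (Reach turn) k →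
    (suc n + suc n) + k + 2 * g ≡ suc n * suc n + 2 → HamiltonianFace (suc n) g
  hamiltonianFace-of C euler = hamiltonianFace (facesFromTurns C) euler (2≤double m m+m≡n+1) d₀ d₀-period d₀-spans

-- Indices modulo r + 1 and residues modulo 2r + 1.

module _ {r : ℕ} where

  down : Fin (suc r) → Fin (suc r)
  down zero    = fromℕ r
  down (suc k) = inject₁ k

  abstract
    up : Fin (suc r) → Fin (suc r)
    up j with view j
    ... | ‵fromℕ     = zero
    ... | ‵inject₁ k = suc k

    up-top : up (fromℕ r) ≡ zero
    up-top rewrite view-fromℕ r = refl

    up-inject₁ : ∀ k → up (inject₁ k) ≡ suc k
    up-inject₁ k rewrite view-inject₁ k = refl

  up-down : ∀ j → up (down j) ≡ j
  up-down zero    = up-top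
  up-down (suc k) = up-inject₁ k

  down-up : ∀ j → down (up j) ≡ j
  down-up j with view j
  ... | ‵fromℕ     = cong down up-top
  ... | ‵inject₁ k = cong down (up-inject₁ k)

  up-cyclic : Cyclic up
  up-cyclic = cyclic-hub zero
    (<-weakInduction (Reach up zero) reach-refl (λ k z↝k → z↝k ⨾ reach-step (up-inject₁ k)))
    (>-weakInduction (λ j → Reach up j zero) (reach-step up-top)
      (λ k k↝z → reach-step (up-inject₁ k) ⨾ k↝z))

module CyclicGroup {Z : Set} (s : Z → Z) (s-cyclic : Cyclic s) (o : Z) where

  infixl 6 _⊕_

  private
    index : Z → ℕ
    index x = proj₁ (s-cyclic o x)

    index-≡ : ∀ x → fold o s (index x) ≡ x
    index-≡ x = proj₂ (s-cyclic o x)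

  abstract
    -- Addition is iteration of `s`. By `⊕-fold` the number of steps chosen to represent an element
    -- is immaterial.
    _⊕_ : Z → Z → Z
    x ⊕ y = fold y s (index x)

    ⊕-identityʳ : ∀ x → x ⊕ o ≡ x
    ⊕-identityʳ = index-≡

    ⊕-fold : ∀ x k → x ⊕ fold o s k ≡ fold x s k
    ⊕-fold x k = begin
      fold (fold o s k) s (index x)  ≡⟨ fold-+ o s (index x) ⟨
      fold o s (index x + k)         ≡⟨ cong (fold o s) (ℕ.+-comm (index x) k) ⟩
      fold o s (k + index x)         ≡⟨ fold-+ o s k ⟩
      fold (fold o s (index x)) s k  ≡⟨ cong (λ z → fold z s k) (index-≡ x) ⟩
      fold x s k                     ∎
      where open ≡-Reasoning

    ⊕-comm : ∀ x y → x ⊕ y ≡ y ⊕ x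
    ⊕-comm x y = trans (cong (x ⊕_) (sym (index-≡ y))) (⊕-fold x (index y))

  ⊕-suc : ∀ x y → x ⊕ s y ≡ s (x ⊕ y)
  ⊕-suc x y with s-cyclic o y
  ... | k , refl = trans (⊕-fold x (suc k)) (cong s (sym (⊕-fold x k)))

  ⊕-one : ∀ x → x ⊕ s o ≡ s x
  ⊕-one x = trans (⊕-suc x o) (cong s (⊕-identityʳ x))

  ⊕-assoc : ∀ x y z → (x ⊕ y) ⊕ z ≡ x ⊕ (y ⊕ z)
  ⊕-assoc x y z with s-cyclic o z
  ... | k , refl = trans (⊕-fold (x ⊕ y) k) (sym (go k))
    where
    go : ∀ k → x ⊕ (y ⊕ fold o s k) ≡ fold (x ⊕ y) s k
    go zero    = cong (x ⊕_) (⊕-identityʳ y)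
    go (suc k) = trans (cong (x ⊕_) (⊕-suc y _)) (trans (⊕-suc x _) (cong s (go k)))

data Residue (r : ℕ) : Set where
  o       : Residue r
  pos neg : Fin r → Residue r

module Residues (r : ℕ) where

  Z : Set
  Z = Residue r

  e : Fin (suc r) → Z
  e zero    = o
  e (suc k) = pos k

  ν : Z → Z
  ν o       = o
  ν (pos k) = neg k
  ν (neg k) = pos k

  top : Fin (suc r)
  top = fromℕ r

  -- This is -r, hence also r + 1, the successor of the largest positive residue.
  h : Z
  h = ν (e top)

  suc⁺ : Fin (suc r) → Z
  suc⁺ j with view j
  ... | ‵fromℕ     = h
  ... | ‵inject₁ k = pos k

  s : Z → Z
  s o       = suc⁺ zero
  s (pos k) = suc⁺ (suc k)
  s (neg k) = ν (e (inject₁ k))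

  s-e : ∀ j → s (e j) ≡ suc⁺ j
  s-e zero    = refl
  s-e (suc k) = refl

  s-e-top : s (e top) ≡ h
  s-e-top rewrite s-e top | view-fromℕ r = refl

  s-e-inject₁ : ∀ k → s (e (inject₁ k)) ≡ e (suc k)
  s-e-inject₁ k rewrite s-e (inject₁ k) | view-inject₁ k = refl

  s-cyclic : Cyclic s
  s-cyclic = cyclic-hub o from to
    where
    o↝e : ∀ j → Reach s o (e j)
    o↝e = <-weakInduction _ reach-refl (λ k o↝k → o↝k ⨾ reach-step (s-e-inject₁ k))
    o↝νe : ∀ j → Reach s o (ν (e j))
    o↝νe = >-weakInduction _ (o↝e top ⨾ reach-step s-e-top) (λ k o↝k → o↝k ⨾ reach-step refl)
    νe↝o : ∀ j → Reach s (ν (e j)) o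
    νe↝o = <-weakInduction _ reach-refl (λ k k↝o → reach-step refl ⨾ k↝o)
    e↝o : ∀ j → Reach s (e j) o
    e↝o = >-weakInduction _ (reach-step s-e-top ⨾ νe↝o top)
                            (λ k k↝o → reach-step (s-e-inject₁ k) ⨾ k↝o)
    from : ∀ x → Reach s o x
    from o       = reach-refl
    from (pos k) = o↝e (suc k)
    from (neg k) = o↝νe (suc k)
    to : ∀ x → Reach s x o
    to o       = reach-refl
    to (pos k) = e↝o (suc k)
    to (neg k) = νe↝o (suc k)

  open CyclicGroup s s-cyclic o public

  infixl 6 _⊖_

  _⊖_ : Z → Z → Z
  x ⊖ y = x ⊕ ν y

  -- Induction moves one unit between the summands: (a + 1) + (-a - 1) = a + (-a).
  e⊖e : ∀ j → e j ⊖ e j ≡ o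
  e⊖e = <-weakInduction _ (⊕-identityʳ o) λ k eq → begin
    e (suc k) ⊕ neg k                 ≡⟨ cong (_⊕ neg k) (s-e-inject₁ k) ⟨
    s (e (inject₁ k)) ⊕ neg k         ≡⟨ ⊕-comm _ (neg k) ⟩
    neg k ⊕ s (e (inject₁ k))         ≡⟨ ⊕-suc (neg k) _ ⟩
    s (neg k ⊕ e (inject₁ k))         ≡⟨ cong s (⊕-comm (neg k) _) ⟩
    s (e (inject₁ k) ⊕ neg k)         ≡⟨ ⊕-suc _ (neg k) ⟨
    e (inject₁ k) ⊕ s (neg k)         ≡⟨ eq ⟩
    o                                 ∎
    where open ≡-Reasoning

  ⊕-inverseʳ : ∀ x → x ⊖ x ≡ o
  ⊕-inverseʳ o       = e⊖e zero
  ⊕-inverseʳ (pos k) = e⊖e (suc k)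
  ⊕-inverseʳ (neg k) = trans (⊕-comm (neg k) (pos k)) (e⊖e (suc k))

  ν-involutive : ∀ x → ν (ν x) ≡ x
  ν-involutive o       = refl
  ν-involutive (pos k) = refl
  ν-involutive (neg k) = refl

  x⊕y⊖y : ∀ x y → x ⊕ y ⊖ y ≡ x
  x⊕y⊖y x y = trans (⊕-assoc x y (ν y)) (trans (cong (x ⊕_) (⊕-inverseʳ y)) (⊕-identityʳ x))

  x⊖y⊕y : ∀ x y → x ⊖ y ⊕ y ≡ x
  x⊖y⊕y x y = trans (cong (x ⊖ y ⊕_) (sym (ν-involutive y))) (x⊕y⊖y x (ν y))

  x⊕y⊖x : ∀ x y → x ⊕ y ⊖ x ≡ y
  x⊕y⊖x x y = trans (cong (_⊖ x) (⊕-comm x y)) (x⊕y⊖y y x)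

  x⊕[y⊖x] : ∀ x y → x ⊕ (y ⊖ x) ≡ y
  x⊕[y⊖x] x y = trans (⊕-comm x (y ⊖ x)) (x⊖y⊕y y x)

  ⊕-cancelˡ : ∀ x {y z} → x ⊕ y ≡ x ⊕ z → y ≡ z
  ⊕-cancelˡ x {y} {z} eq = trans (sym (x⊕y⊖x x y)) (trans (cong (_⊖ x) eq) (x⊕y⊖x x z))

  x⊖[x⊕y] : ∀ x y → x ⊖ (x ⊕ y) ≡ ν y
  x⊖[x⊕y] x y = ⊕-cancelˡ (x ⊕ y) (trans (x⊕[y⊖x] (x ⊕ y) x) (sym (x⊕y⊖y x y)))

  x⊖[x⊖y] : ∀ x y → x ⊖ (x ⊖ y) ≡ y
  x⊖[x⊖y] x y = trans (x⊖[x⊕y] x (ν y)) (ν-involutive y)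

  h⊕h : h ⊕ h ≡ s o
  h⊕h = begin
    h ⊕ h             ≡⟨ cong (h ⊕_) s-e-top ⟨
    h ⊕ s (e top)     ≡⟨ ⊕-suc h (e top) ⟩
    s (h ⊕ e top)     ≡⟨ cong s (trans (⊕-comm h (e top)) (⊕-inverseʳ (e top))) ⟩
    s o               ∎
    where open ≡-Reasoning

  translate-one-cyclic : Cyclic (_⊕ s o)
  translate-one-cyclic = cyclic-conj id s-cyclic ⊕-one (λ x → x , refl)

  -- h is half of the generator.
  translate-h-cyclic : Cyclic (_⊕ h)
  translate-h-cyclic = cyclic-lift id translate-one-cyclic
    (λ x → 2 , trans (⊕-assoc x h h) (cong (x ⊕_) h⊕h))
    (λ x → x , reach-refl) (λ x → x , reach-refl)

  translate-e-top-cyclic : Cyclic (_⊕ e top)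
  translate-e-top-cyclic = cyclic-leftInverse translate-h-cyclic (λ x → x⊖y⊕y x (e top))

  -- k times `h` is half of k. This provides the midpoint of two residues.
  halve : ∀ x → ∃[ y ] y ⊕ y ≡ x
  halve x with s-cyclic o x
  ... | k , refl = fold o (_⊕ h) k , go k
    where
    open ≡-Reasoning
    go : ∀ k → fold o (_⊕ h) k ⊕ fold o (_⊕ h) k ≡ fold o s k
    go zero    = ⊕-identityʳ o
    go (suc k) = begin
      (y ⊕ h) ⊕ (y ⊕ h)  ≡⟨ ⊕-assoc (y ⊕ h) y h ⟨
      (y ⊕ h) ⊕ y ⊕ h    ≡⟨ cong (_⊕ h) (trans (⊕-comm (y ⊕ h) y) (sym (⊕-assoc y y h))) ⟩
      y ⊕ y ⊕ h ⊕ h      ≡⟨ ⊕-assoc (y ⊕ y) h h ⟩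
      y ⊕ y ⊕ (h ⊕ h)    ≡⟨ cong₂ _⊕_ (go k) h⊕h ⟩
      fold o s k ⊕ s o   ≡⟨ ⊕-one _ ⟩
      s (fold o s k)     ∎
      where y = fold o (_⊕ h) k

  -- Equal to 1 for j < r and to `h` for j = r. The arc g_j → x of the white polygon i is that of
  -- the black polygon `i ⊕ δ j`.
  δ : Fin (suc r) → Z
  δ j = e (up j) ⊖ e j

  δ-top : δ top ≡ h
  δ-top = trans (cong (λ j → e j ⊖ e top) up-top) (trans (⊕-comm o h) (⊕-identityʳ h))

  δ-inject₁ : ∀ k → δ (inject₁ k) ≡ s o
  δ-inject₁ k = begin
    e (up (inject₁ k)) ⊖ e (inject₁ k) ≡⟨ cong (λ j → e j ⊖ e (inject₁ k)) (up-inject₁ k) ⟩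
    e (suc k) ⊖ e (inject₁ k)          ≡⟨ cong (_⊖ e (inject₁ k)) (trans (sym (s-e-inject₁ k)) (sym (⊕-one _))) ⟩
    e (inject₁ k) ⊕ s o ⊖ e (inject₁ k) ≡⟨ x⊕y⊖x _ (s o) ⟩
    s o                                ∎
    where open ≡-Reasoning

  translate-δ-cyclic : ∀ j → Cyclic (_⊕ δ j)
  translate-δ-cyclic j with view j
  ... | ‵fromℕ     = subst (λ x → Cyclic (_⊕ x)) (sym δ-top) translate-h-cyclic
  ... | ‵inject₁ k = subst (λ x → Cyclic (_⊕ x)) (sym (δ-inject₁ k)) translate-one-cyclic

  -- The residues are the −e j together with the pos k, and the e j together
  -- with the neg k.
  elim⁻ : {A : Set} → (Fin (suc r) → A) → (Fin r → A) → Z → A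
  elim⁻ f g o       = f zero
  elim⁻ f g (neg k) = f (suc k)
  elim⁻ f g (pos k) = g k

  elim⁺ : {A : Set} → (Fin (suc r) → A) → (Fin r → A) → Z → A
  elim⁺ f g o       = f zero
  elim⁺ f g (pos k) = f (suc k)
  elim⁺ f g (neg k) = g k

  elim⁻-νe : {A : Set} (f : Fin (suc r) → A) (g : Fin r → A) → ∀ j → elim⁻ f g (ν (e j)) ≡ f j
  elim⁻-νe f g zero    = refl
  elim⁻-νe f g (suc k) = refl

  elim⁺-e : {A : Set} (f : Fin (suc r) → A) (g : Fin r → A) → ∀ j → elim⁺ f g (e j) ≡ f j
  elim⁺-e f g zero    = refl
  elim⁺-e f g (suc k) = refl

  data View⁻ : Z → Set where
    ‵νe  : ∀ j → View⁻ (ν (e j))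
    ‵pos : ∀ k → View⁻ (pos k)

  view⁻ : ∀ x → View⁻ x
  view⁻ o       = ‵νe zero
  view⁻ (neg k) = ‵νe (suc k)
  view⁻ (pos k) = ‵pos k

-- The translated polygons and their gluing.

-- The vertex N x is inserted between F j and G j in all polygons, where j = home x.
record Detours (r : ℕ) (E : Set) : Set where
  open Residues r
  field
    detour       : Fin (suc r) → Maybe E
    home         : E → Fin (suc r)
    detour-home  : ∀ x → detour (home x) ≡ just x
    home-detour  : ∀ {j x} → detour j ≡ just x → home x ≡ j
    -- The arc `N x` → `G j` of the white polygon i is glued to that of the black polygon
    -- `i ⊕ shift j`. The rotation at `N x` becomes translation by the shift, and the one at `G j`
    -- loses it from `δ j`.
    shift        : Fin (suc r) → Z
    shift-none   : ∀ {j} → detour j ≡ nothing → shift j ≡ o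
    shift-cyclic : ∀ x → Cyclic (_⊕ shift (home x))
    spin-cyclic  : ∀ j → Cyclic (λ i → i ⊕ δ j ⊖ shift j)

module Polygons {r : ℕ} {E : Set} (𝓓 : Detours r E) where

  open Residues r
  open Detours 𝓓

  data V : Set where
    X   : Z → V
    F G : Fin (suc r) → V
    N   : E → V

  -- One form for both colours: x_{i-j} leads to f_{t j}, and g_j to x_{i+g j}. With g ∘ t = `up`,
  -- the block entered from x_{i-j} is left to x_{i+j+1}, j being taken modulo r + 1.
  next : (t g : Fin (suc r) → Fin (suc r)) → Z → V → V
  next t g i (X x) = elim⁻ (F ∘ t) (λ k → X (i ⊕ neg k)) (x ⊖ i)
  next t g i (F j) = maybe′ N (G j) (detour j)
  next t g i (G j) = X (i ⊕ e (g j))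
  next t g i (N x) = G (home x)

  module _ (t g t⁻¹ : Fin (suc r) → Fin (suc r)) where

    next-νe : ∀ {i x} j → x ⊖ i ≡ ν (e j) → next t g i (X x) ≡ F (t j)
    next-νe j eq rewrite eq = elim⁻-νe _ _ j

    next-pos : ∀ {i x k} → x ⊖ i ≡ pos k → next t g i (X x) ≡ X (i ⊕ neg k)
    next-pos eq rewrite eq = refl

    module _ (t-t⁻¹ : ∀ j → t (t⁻¹ j) ≡ j) (g-t : ∀ j → g (t j) ≡ up j) (i : Z) where

      private
        infix 4 _↝_
        _↝_ : V → V → Set
        _↝_ = Reach (next t g i)

      e↝νe : ∀ j → X (i ⊕ e j) ↝ X (i ⊕ ν (e j))
      e↝νe zero    = reach-refl
      e↝νe (suc k) = reach-step (next-pos (x⊕y⊖x i (pos k)))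

      νe↝F : ∀ j → X (i ⊕ ν (e j)) ↝ F (t j)
      νe↝F j = reach-step (next-νe j (x⊕y⊖x i _))

      F↝G : ∀ j → F j ↝ G j
      F↝G j with detour j in eq
      ... | nothing = reach-step (cong (maybe′ N (G j)) eq)
      ... | just x  = reach-step (cong (maybe′ N (G j)) eq) ⨾ reach-step (cong G (home-detour eq))

      F↝N : ∀ x → F (home x) ↝ N x
      F↝N x = reach-step (cong (maybe′ N (G (home x))) (detour-home x))

      G↝e : ∀ j → G (t j) ↝ X (i ⊕ e (up j))
      G↝e j = reach-step (cong (λ j → X (i ⊕ e j)) (g-t j))

      from-e : ∀ v → ∃[ j ] X (i ⊕ e j) ↝ v
      from-e (F j) = t⁻¹ j , subst (λ j′ → X (i ⊕ e (t⁻¹ j)) ↝ F j′) (t-t⁻¹ j) (e↝νe _ ⨾ νe↝F _)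
      from-e (G j) = let j′ , r = from-e (F j) in j′ , r ⨾ F↝G j
      from-e (N x) = let j′ , r = from-e (F (home x)) in j′ , r ⨾ F↝N x
      from-e (X x) with x ⊖ i | x⊕[y⊖x] i x
      ... | u | refl with view⁻ u
      ...   | ‵νe j  = j , e↝νe j
      ...   | ‵pos k = suc k , reach-refl

      G-to-e : ∀ j → ∃[ j′ ] G j ↝ X (i ⊕ e j′)
      G-to-e j = up (t⁻¹ j) , subst (λ j′ → G j′ ↝ X (i ⊕ e (up (t⁻¹ j)))) (t-t⁻¹ j) (G↝e (t⁻¹ j))

      to-e : ∀ v → ∃[ j ] v ↝ X (i ⊕ e j)
      to-e (G j) = G-to-e j
      to-e (F j) = let j′ , r = G-to-e j in j′ , F↝G j ⨾ r
      to-e (N x) = let j′ , r = G-to-e (home x) in j′ , reach-step refl ⨾ r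
      to-e (X x) with x ⊖ i | x⊕[y⊖x] i x
      ... | u | refl with view⁻ u
      ...   | ‵νe j  = let j′ , r = G-to-e (t j) in j′ , νe↝F j ⨾ F↝G (t j) ⨾ r
      ...   | ‵pos k = suc k , reach-refl

      next-cyclic : Cyclic (next t g i)
      next-cyclic = cyclic-lift (λ j → X (i ⊕ e j)) up-cyclic
        (λ j → e↝νe j ⨾ νe↝F j ⨾ F↝G (t j) ⨾ G↝e j) from-e to-e

  nextᵂ nextᴷ : Z → V → V
  nextᵂ = next id up
  nextᴷ = next up id

  nextᵂ-cyclic : ∀ i → Cyclic (nextᵂ i)
  nextᵂ-cyclic = next-cyclic id up id (λ _ → refl) (λ _ → refl)

  nextᴷ-cyclic : ∀ k → Cyclic (nextᴷ k)
  nextᴷ-cyclic = next-cyclic up id down up-down (λ _ → refl)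

  -- For arcs x → f, x → x and g → x the number is forced by the ends. For the arcs that occur in
  -- all polygons it is a choice, namely i or i plus the shift.
  out : V → Z → Z
  out (X x) i = elim⁻ (λ j → x ⊕ e (down j)) (λ _ → i) (x ⊖ i)
  out (F j) i = i
  out (G j) i = i ⊕ δ j
  out (N x) i = i ⊕ shift (home x)

  back : V → Z → Z
  back (X x) k = elim⁺ (λ j → x ⊖ e (up j)) (λ _ → k) (x ⊖ k)
  back (F j) k = k ⊕ δ (down j)
  back (G j) k = k ⊖ shift j
  back (N x) k = k

  out-νe : ∀ {x i} j → x ⊖ i ≡ ν (e j) → out (X x) i ≡ x ⊕ e (down j)
  out-νe j eq rewrite eq = elim⁻-νe _ _ j

  out-pos : ∀ {x i k} → x ⊖ i ≡ pos k → out (X x) i ≡ i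
  out-pos eq rewrite eq = refl

  back-e : ∀ {x k} j → x ⊖ k ≡ e j → back (X x) k ≡ x ⊖ e (up j)
  back-e j eq rewrite eq = elim⁺-e _ _ j

  back-neg : ∀ {x k l} → x ⊖ k ≡ neg l → back (X x) k ≡ k
  back-neg eq rewrite eq = refl

  module _ (x : Z) where

    private
      R : Z → Z
      R i = back (X x) (out (X x) i)

      infix 4 _↝_
      _↝_ : Z → Z → Set
      u ↝ v = Reach R (x ⊖ u) (x ⊖ v)

      -- In the coordinate u = `x ⊖ i` the rotation at x runs through 0, -r, ..., -1, 1, ..., r and
      -- back to 0. `pass` is -j for j > 0, and at j = 0 it steps over 0, from -1 to 1.
      pass : Fin (suc r) → Z
      pass zero    = e (up zero)
      pass (suc l) = neg l

      back-pass : ∀ j → back (X x) (x ⊕ e j) ≡ x ⊖ pass j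
      back-pass zero    = back-e zero (x⊖[x⊕y] x o)
      back-pass (suc l) = back-neg (x⊖[x⊕y] x (pos l))

      νe↝pass : ∀ j → ν (e j) ↝ pass (down j)
      νe↝pass j = reach-step (trans (cong (back (X x)) (out-νe j (x⊖[x⊖y] x _))) (back-pass (down j)))

      pos↝e : ∀ l → pos l ↝ e (up (suc l))
      pos↝e l = reach-step (trans (cong (back (X x)) (out-pos (x⊖[x⊖y] x (pos l))))
                                  (back-e (suc l) (x⊖[x⊖y] x (pos l))))

      o↝pass⇒o↝νe : ∀ j → o ↝ pass j → o ↝ ν (e j)
      o↝pass⇒o↝νe zero    _ = reach-refl
      o↝pass⇒o↝νe (suc l) r = r

      o↝νe : ∀ j → o ↝ ν (e j)
      o↝νe = >-weakInduction _ (o↝pass⇒o↝νe top (νe↝pass zero))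
        (λ k o↝k → o↝pass⇒o↝νe (inject₁ k) (o↝k ⨾ νe↝pass (suc k)))

      o↝e-up-zero : ∀ j → up zero ≡ j → o ↝ e j
      o↝e-up-zero zero    _  = reach-refl
      o↝e-up-zero (suc k) eq =
        subst (λ j → o ↝ e j) eq
          (subst (λ j → o ↝ pass j) (trans (cong down (sym eq)) (down-up zero)) (o↝νe (suc k) ⨾ νe↝pass (suc k)))

      e↝e-up : ∀ j → o ↝ e j → o ↝ e (up j)
      e↝e-up zero    _ = o↝e-up-zero (up zero) refl
      e↝e-up (suc l) r = r ⨾ pos↝e l

      o↝e : ∀ j → o ↝ e j
      o↝e = <-weakInduction _ reach-refl
        (λ k o↝k → subst (λ j → o ↝ e j) (up-inject₁ k) (e↝e-up (inject₁ k) o↝k))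

      e-up↝o : ∀ j → e (up j) ↝ o → e j ↝ o
      e-up↝o zero    _ = reach-refl
      e-up↝o (suc l) r = pos↝e l ⨾ r

      e↝o : ∀ j → e j ↝ o
      e↝o = >-weakInduction _ (e-up↝o top (subst (λ j → e j ↝ o) (sym up-top) reach-refl))
        (λ k k↝o → e-up↝o (inject₁ k) (subst (λ j → e j ↝ o) (sym (up-inject₁ k)) k↝o))

      pass↝o : ∀ j → ν (e j) ↝ o → pass j ↝ o
      pass↝o zero    _ = e↝o (up zero)
      pass↝o (suc l) r = r

      νe↝o : ∀ j → ν (e j) ↝ o
      νe↝o = <-weakInduction _ reach-refl (λ k k↝o → νe↝pass (suc k) ⨾ pass↝o (inject₁ k) k↝o)

      from-o : ∀ u → o ↝ u
      from-o o       = reach-refl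
      from-o (pos k) = o↝e (suc k)
      from-o (neg k) = o↝νe (suc k)

      to-o : ∀ u → u ↝ o
      to-o o       = reach-refl
      to-o (pos k) = e↝o (suc k)
      to-o (neg k) = νe↝o (suc k)

    turn-X-cyclic : Cyclic R
    turn-X-cyclic i j = subst₂ (Reach R) (x⊖[x⊖y] x i) (x⊖[x⊖y] x j) (to-o (x ⊖ i) ⨾ from-o (x ⊖ j))

  turn-cyclic : ∀ v → Cyclic (λ i → back v (out v i))
  turn-cyclic (X x) = turn-X-cyclic x
  turn-cyclic (F j) = translate-δ-cyclic (down j)
  turn-cyclic (G j) = spin-cyclic j
  turn-cyclic (N x) = shift-cyclic x

  out-onto : ∀ v k → ∃[ i ] out v i ≡ k
  out-onto (F j) k = k , refl
  out-onto (G j) k = k ⊖ δ j , x⊖y⊕y k (δ j)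
  out-onto (N x) k = k ⊖ shift (home x) , x⊖y⊕y k _
  out-onto (X x) k with x ⊖ k | x⊖[x⊖y] x k
  ... | u | refl with view⁻ u
  ...   | ‵νe j  = x ⊖ ν (e (up j)) , trans (out-νe (up j) (x⊖[x⊖y] x _))
                     (cong (x ⊕_) (trans (cong e (down-up j)) (sym (ν-involutive (e j)))))
  ...   | ‵pos l = x ⊖ pos l , out-pos (x⊖[x⊖y] x (pos l))

  x⊕a⊕[b⊖a] : ∀ x a b → x ⊕ a ⊕ (b ⊖ a) ≡ x ⊕ b
  x⊕a⊕[b⊖a] x a b = trans (⊕-assoc x a _) (cong (x ⊕_) (x⊕[y⊖x] a b))

  x⊕[b⊖a]⊕a : ∀ x a b → x ⊕ (b ⊖ a) ⊕ a ≡ x ⊕ b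
  x⊕[b⊖a]⊕a x a b = trans (⊕-assoc x _ a) (cong (x ⊕_) (x⊖y⊕y b a))

  quad : ∀ v i → back (nextᴷ (out v i) v) (out v i) ≡ i × nextᵂ i v ≡ nextᴷ (out v i) v
  quad (X x) i with x ⊖ i in eq | x⊖[x⊖y] x i
  ... | u | refl with view⁻ u
  ...   | ‵pos k rewrite next-pos up id id {x = x} eq = back-neg (x⊕y⊖x _ (neg k)) , refl
  ...   | ‵νe j rewrite elim⁻-νe (λ j → x ⊕ e (down j)) (λ _ → x ⊖ ν (e j)) j
                      | next-νe up id id (down j) (x⊖[x⊕y] x (e (down j)))
                      | up-down j =
    trans (x⊕a⊕[b⊖a] x _ _) (cong (x ⊕_) (trans (cong e (up-down j)) (sym (ν-involutive (e j))))) ,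
    elim⁻-νe F _ j
  quad (F j) i with detour j in eq
  ... | nothing = trans (cong (λ x → i ⊖ x) (shift-none eq)) (⊕-identityʳ i) , refl
  ... | just x  = refl , refl
  quad (N x) i = x⊕y⊖y i _ , refl
  quad (G j) i =
    trans (back-e j (x⊕y⊖x _ (e j)))
      (trans (cong (_⊖ e (up j)) eq) (x⊕y⊖y i (e (up j)))) ,
    cong X (sym eq)
    where
    eq : i ⊕ δ j ⊕ e j ≡ i ⊕ e (up j)
    eq = x⊕[b⊖a]⊕a i (e j) (e (up j))

  next-to-F : ∀ z j → ∃[ k ] nextᴷ k (X z) ≡ F j
  next-to-F z j = z ⊕ e (down j) , trans (next-νe up id id (down j) (x⊖[x⊕y] z _)) (cong F (up-down j))

  next-from-G : ∀ z j → nextᵂ (z ⊖ e (up j)) (G j) ≡ X z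
  next-from-G z j = cong X (x⊖y⊕y z _)

  -- The polygon in which x_y and x_z are consecutive is numbered by their midpoint.
  neighbour-X : ∀ z y → y ≢ z → (∃[ k ] nextᵂ (z ⊕ pos k) (X y) ≡ X z) ⊎ (∃[ k ] nextᴷ k (X z) ≡ X y)
  neighbour-X z y y≢z with halve (y ⊖ z)
  ... | q , eq with trans (⊕-assoc z q q) (trans (cong (z ⊕_) eq) (x⊕[y⊖x] z y))
  ...   | refl with q
  ...     | o     = contradiction (trans (⊕-identityʳ _) (⊕-identityʳ z)) y≢z
  ...     | pos k = inj₁ (k , trans (next-pos id up id (x⊕y⊖x _ (pos k))) (cong X (x⊕y⊖y z (pos k))))
  ...     | neg k = inj₂ (z ⊕ neg k , next-pos up id id (x⊖[x⊕y] z (neg k)))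

residue↔ : ∀ r → Residue r ↔ Fin (suc (r + r))
residue↔ r = ↔-sym Fin.+↔⊎ ↔-∘ mk↔ₛ′ to from to-from from-to
  where
  to : Residue r → Fin (suc r) ⊎ Fin r
  to o       = inj₁ zero
  to (pos k) = inj₁ (suc k)
  to (neg k) = inj₂ k
  from : Fin (suc r) ⊎ Fin r → Residue r
  from (inj₁ zero)    = o
  from (inj₁ (suc k)) = pos k
  from (inj₂ k)       = neg k
  to-from : ∀ x → to (from x) ≡ x
  to-from (inj₁ zero)    = refl
  to-from (inj₁ (suc k)) = refl
  to-from (inj₂ k)       = refl
  from-to : ∀ x → from (to x) ≡ x
  from-to o       = refl
  from-to (pos k) = refl
  from-to (neg k) = refl

-- The case n = 4r + 2.

module Odd (r : ℕ) where

  open Residues r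

  noDetours : Detours r ⊥
  noDetours = record
    { detour = λ _ → nothing ; home = λ () ; detour-home = λ () ; home-detour = λ ()
    ; shift = λ _ → o ; shift-none = λ _ → refl ; shift-cyclic = λ ()
    ; spin-cyclic = λ j → cyclic-≗ (λ i → sym (⊕-identityʳ (i ⊕ δ j))) (translate-δ-cyclic j) }

  open Polygons noDetours

  V⁻ : Set
  V⁻ = (Fin r ⊎ Fin r) ⊎ (Fin (suc r) ⊎ Fin (suc r))

  ⟦_⟧ : V⁻ → V
  ⟦ inj₁ (inj₁ k) ⟧ = X (pos k)
  ⟦ inj₁ (inj₂ k) ⟧ = X (neg k)
  ⟦ inj₂ (inj₁ j) ⟧ = F j
  ⟦ inj₂ (inj₂ j) ⟧ = G j

  decode : V → Maybe V⁻
  decode (X o)       = nothing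
  decode (X (pos k)) = just (inj₁ (inj₁ k))
  decode (X (neg k)) = just (inj₁ (inj₂ k))
  decode (F j)       = just (inj₂ (inj₁ j))
  decode (G j)       = just (inj₂ (inj₂ j))

  decode-⟦⟧ : ∀ b → decode ⟦ b ⟧ ≡ just b
  decode-⟦⟧ (inj₁ (inj₁ _)) = refl
  decode-⟦⟧ (inj₁ (inj₂ _)) = refl
  decode-⟦⟧ (inj₂ (inj₁ _)) = refl
  decode-⟦⟧ (inj₂ (inj₂ _)) = refl

  split : ∀ v → v ≡ X o ⊎ ∃[ b ] v ≡ ⟦ b ⟧
  split (X o)       = inj₁ refl
  split (X (pos k)) = inj₂ (inj₁ (inj₁ k) , refl)
  split (X (neg k)) = inj₂ (inj₁ (inj₂ k) , refl)
  split (F j)       = inj₂ (inj₂ (inj₁ j) , refl)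
  split (G j)       = inj₂ (inj₂ (inj₂ j) , refl)

  spans-X : ∀ y → y ≢ o → (∃[ i ] nextᵂ i (X y) ≡ X o) ⊎ (∃[ k ] nextᴷ k (X o) ≡ X y)
  spans-X y y≢o with neighbour-X o y y≢o
  ... | inj₁ (k , eq) = inj₁ (o ⊕ pos k , eq)
  ... | inj₂ eq       = inj₂ eq

  spans : ∀ b → (∃[ i ] nextᵂ i ⟦ b ⟧ ≡ X o) ⊎ (∃[ k ] nextᴷ k (X o) ≡ ⟦ b ⟧)
  spans (inj₁ (inj₁ k)) = spans-X (pos k) λ ()
  spans (inj₁ (inj₂ k)) = spans-X (neg k) λ ()
  spans (inj₂ (inj₁ j)) = inj₂ (next-to-F o j)
  spans (inj₂ (inj₂ j)) = inj₁ (_ , next-from-G o j)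

  gluing : Gluing Z Z V V⁻
  gluing = record
    { ∞ = X o ; ⟦_⟧ = ⟦_⟧ ; decode = decode ; decode-∞ = refl ; decode-⟦⟧ = decode-⟦⟧ ; split = split
    ; nextᵂ = nextᵂ ; nextᴷ = nextᴷ ; nextᵂ-cyclic = nextᵂ-cyclic ; nextᴷ-cyclic = nextᴷ-cyclic
    ; out = out ; back = back ; turn-cyclic = turn-cyclic ; out-onto = out-onto
    ; twist = λ _ i → i ; quad = quad ; twist-∞ = λ _ → refl
    ; twist-before-∞ = λ _ → inj₁ λ _ → refl ; spans = spans }

  V⁻↔ : V⁻ ↔ Fin (2 + r * 4)
  V⁻↔ = subst (λ l → V⁻ ↔ Fin l)
    (solve 1 (λ r → r :+ r :+ (con 1 :+ r :+ (con 1 :+ r)) := con 2 :+ r :* con 4) refl r)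
    (↔-sym Fin.+↔⊎ ↔-∘ (↔-sym Fin.+↔⊎ ⊎-↔ ↔-sym Fin.+↔⊎))
    where open +-*-Solver

  hamiltonianFace-odd : HamiltonianFace (2 + r * 4) ((1 + r * 4) * r)
  hamiltonianFace-odd = hamiltonianFace-of (turnClasses-untwisted (λ _ _ → refl))
    (solve 1 (λ r → con 2 :+ r :* con 4 :+ (con 2 :+ r :* con 4) :+
                    (con 1 :+ (con 1 :+ (r :+ r)) :* (con 1 :+ r :* con 4)) :+
                    con 2 :* ((con 1 :+ r :* con 4) :* r) :=
                    (con 2 :+ r :* con 4) :* (con 2 :+ r :* con 4) :+ con 2) refl r)
    where
    open +-*-Solver
    open Assemble gluing (residue↔ r) (residue↔ r) V⁻↔
      (solve 1 (λ r → con 1 :+ (r :+ r) :+ (con 1 :+ (r :+ r)) := con 2 :+ r :* con 4) refl r) o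

-- The case n = 4r + 4 with r > 0.

abstract
  ifTop : ∀ {n} → A → A → Fin (suc n) → A
  ifTop a b k with view k
  ... | ‵fromℕ     = a
  ... | ‵inject₁ _ = b

  ifTop-top : ∀ {n} (a b : A) → ifTop a b (fromℕ n) ≡ a
  ifTop-top {n = n} a b rewrite view-fromℕ n = refl

  ifTop-inject₁ : ∀ {n} (a b : A) (k : Fin n) → ifTop a b (inject₁ k) ≡ b
  ifTop-inject₁ a b k rewrite view-inject₁ k = refl

data Extra : Set where
  P Q : Extra

module Even (r′ : ℕ) where

  r : ℕ
  r = suc r′

  open Residues r

  last : Fin r
  last = fromℕ r′

  twoDetours : Detours r Extra
  twoDetours = record
    { detour = detour ; home = home ; detour-home = detour-home ; home-detour = home-detour
    ; shift = shift ; shift-none = λ {j} → shift-none {j} ; shift-cyclic = shift-cyclic ; spin-cyclic = spin-cyclic }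
    where
    detour : Fin (suc r) → Maybe Extra
    detour zero    = just Q
    detour (suc k) = ifTop (just P) nothing k
    home : Extra → Fin (suc r)
    home P = top
    home Q = zero
    detour-home : ∀ x → detour (home x) ≡ just x
    detour-home P = ifTop-top _ _
    detour-home Q = refl
    home-detour : ∀ {j x} → detour j ≡ just x → home x ≡ j
    home-detour {zero}  refl = refl
    home-detour {suc k} eq with view k
    ... | ‵fromℕ     with refl ← just-injective (trans (sym eq) (ifTop-top _ _)) = refl
    ... | ‵inject₁ l with () ← trans (sym eq) (ifTop-inject₁ _ _ l)
    shift : Fin (suc r) → Z
    -- At `G zero` there remains 1 - h = h, and at `G top`, where the shift is r = -h, there remains
    -- h + h = 1. Each of h, -h and 1 generates.
    shift zero    = h
    shift (suc k) = ifTop (e top) o k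
    shift-none : ∀ {j} → detour j ≡ nothing → shift j ≡ o
    shift-none {suc k} eq with view k
    ... | ‵fromℕ     with () ← trans (sym eq) (ifTop-top _ _)
    ... | ‵inject₁ l = ifTop-inject₁ _ _ l
    shift-cyclic : ∀ x → Cyclic (_⊕ shift (home x))
    shift-cyclic P = cyclic-≗ (λ i → cong (i ⊕_) (sym (ifTop-top _ _))) translate-e-top-cyclic
    shift-cyclic Q = translate-h-cyclic
    spin-cyclic : ∀ j → Cyclic (λ i → i ⊕ δ j ⊖ shift j)
    spin-cyclic zero = cyclic-≗
      (λ i → begin
        i ⊕ h            ≡⟨ x⊕y⊖y (i ⊕ h) h ⟨
        i ⊕ h ⊕ h ⊖ h    ≡⟨ cong (_⊖ h) (trans (⊕-assoc i h h) (cong (i ⊕_) (trans h⊕h (sym (δ-inject₁ zero))))) ⟩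
        i ⊕ δ zero ⊖ h   ∎)
      translate-h-cyclic
      where open ≡-Reasoning
    spin-cyclic (suc k) with view k
    ... | ‵fromℕ = cyclic-≗
      (λ i → begin
        i ⊕ s o                      ≡⟨ trans (cong (i ⊕_) (sym h⊕h)) (sym (⊕-assoc i h h)) ⟩
        i ⊕ h ⊕ h                    ≡⟨ cong₂ (λ x y → i ⊕ x ⊖ y) (sym δ-top) (sym (ifTop-top (e top) o)) ⟩
        i ⊕ δ top ⊖ shift top        ∎)
      translate-one-cyclic
      where open ≡-Reasoning
    ... | ‵inject₁ l = cyclic-≗
      (λ i → begin
        i ⊕ s o                                        ≡⟨ ⊕-identityʳ _ ⟨
        i ⊕ s o ⊖ o                                    ≡⟨ cong₂ (λ x y → i ⊕ x ⊖ y) (sym (δ-inject₁ (suc l))) (sym (ifTop-inject₁ (e top) o l)) ⟩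
        i ⊕ δ (suc (inject₁ l)) ⊖ shift (suc (inject₁ l)) ∎)
      translate-one-cyclic
      where open ≡-Reasoning

  open Polygons twoDetours

  -- `next₀` is W_0 written out, and `next₃` is the new black polygon. At each vertex one of
  -- `next₁`, `next₂` agrees with `next₀` and the other with `next₃`, as the parity of the vertex
  -- prescribes (interchanged at `F top`). So only `next₃` is to be chosen, such that all three
  -- orders are cyclic; it rearranges just seven vertices.
  next₀ next₁ next₂ next₃ : V → V

  next₀ (X o)       = F zero
  next₀ (X (pos k)) = X (neg k)
  next₀ (X (neg k)) = F (suc k)
  next₀ (F zero)    = N Q
  next₀ (F (suc k)) = ifTop (N P) (G (suc k)) k
  next₀ (G j)       = X (e (up j))
  next₀ (N P)       = G top
  next₀ (N Q)       = G zero

  next₁ (X o)       = F zero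
  next₁ (X (pos k)) = X (neg k)
  next₁ (X (neg k)) = ifTop (N P) (F (suc k)) k
  next₁ (F zero)    = F top
  next₁ (F (suc k)) = ifTop (N Q) (G (suc k)) k
  next₁ (G j)       = X (e (up j))
  next₁ (N P)       = G top
  next₁ (N Q)       = G zero

  next₂ (X o)       = F zero
  next₂ (X (pos k)) = ifTop (G top) (X (neg k)) k
  next₂ (X (neg k)) = F (suc k)
  next₂ (F zero)    = N Q
  next₂ (F (suc k)) = ifTop (N P) (G (suc k)) k
  next₂ (G j)       = X (e (up j))
  next₂ (N P)       = G zero
  next₂ (N Q)       = X (neg last)

  next₃ (X o)       = F zero
  next₃ (X (pos k)) = ifTop (G top) (X (neg k)) k
  next₃ (X (neg k)) = ifTop (N P) (F (suc k)) k
  next₃ (F zero)    = F top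
  next₃ (F (suc k)) = ifTop (N Q) (G (suc k)) k
  next₃ (G j)       = X (e (up j))
  next₃ (N P)       = G zero
  next₃ (N Q)       = X (neg last)

  x⊖o : ∀ x → x ⊖ o ≡ x
  x⊖o = ⊕-identityʳ

  o⊕x : ∀ x → o ⊕ x ≡ x
  o⊕x x = trans (⊕-comm o x) (⊕-identityʳ x)

  nextᵂ-o : ∀ v → nextᵂ o v ≡ next₀ v
  nextᵂ-o (X o)       = next-νe id up id zero (x⊖o o)
  nextᵂ-o (X (neg k)) = next-νe id up id (suc k) (x⊖o (neg k))
  nextᵂ-o (X (pos k)) = trans (next-pos id up id (x⊖o (pos k))) (cong X (o⊕x (neg k)))
  nextᵂ-o (F zero)    = refl
  nextᵂ-o (F (suc k)) with view k
  ... | ‵fromℕ     = trans (cong (maybe′ N (G top)) (ifTop-top _ _)) (sym (ifTop-top _ _))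
  ... | ‵inject₁ l = trans (cong (maybe′ N (G (suc (inject₁ l)))) (ifTop-inject₁ _ _ l)) (sym (ifTop-inject₁ _ _ l))
  nextᵂ-o (G j)       = cong X (o⊕x _)
  nextᵂ-o (N P)       = refl
  nextᵂ-o (N Q)       = refl

  -- The common part G zero … X (pos last) of the three new polygons, closed up by
  -- seven further vertices.
  module Long (f : V → V)
    (G↦X : ∀ k → f (G (inject₁ k)) ≡ X (pos k))
    (X↦X : ∀ l → f (X (pos (inject₁ l))) ≡ X (neg (inject₁ l)))
    (X↦F : ∀ l → f (X (neg (inject₁ l))) ≡ F (suc (inject₁ l)))
    (F↦G : ∀ l → f (F (suc (inject₁ l))) ≡ G (suc (inject₁ l)))
    (p : Fin 7 → V)
    (enter-p : f (X (pos last)) ≡ p 0F)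
    (p↦p : ∀ k → f (p (inject₁ k)) ≡ p (suc k))
    (leave-p : f (p 6F) ≡ G zero)
    (at-o : ∃[ k ] p k ≡ X o) (at-last : ∃[ k ] p k ≡ X (neg last))
    (at-F₀ : ∃[ k ] p k ≡ F zero) (at-Fₜ : ∃[ k ] p k ≡ F top)
    (at-Gₜ : ∃[ k ] p k ≡ G top) (at-N : ∀ x → ∃[ k ] p k ≡ N x) where

    infix 4 _↝_
    _↝_ : V → V → Set
    _↝_ = Reach f

    block : ∀ l → G (inject₁ (inject₁ l)) ↝ G (suc (inject₁ l))
    block l = reach-step (G↦X (inject₁ l)) ⨾ reach-step (X↦X l) ⨾ reach-step (X↦F l) ⨾ reach-step (F↦G l)

    start↝G : ∀ k → G zero ↝ G (inject₁ k)
    start↝G = <-weakInduction _ reach-refl (λ l r → r ⨾ block l)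

    G↝end : ∀ k → G (inject₁ k) ↝ X (pos last)
    G↝end = >-weakInduction _ (reach-step (G↦X last)) (λ l r → block l ⨾ r)

    end↝p : ∀ k → X (pos last) ↝ p k
    end↝p = <-weakInduction _ (reach-step enter-p) (λ k r → r ⨾ reach-step (p↦p k))

    p↝start : ∀ k → p k ↝ G zero
    p↝start = >-weakInduction _ (reach-step leave-p) (λ k r → reach-step (p↦p k) ⨾ r)

    Between : V → Set
    Between v = G zero ↝ v × v ↝ G zero

    on-path : ∀ {v} → ∃[ k ] p k ≡ v → Between v
    on-path (k , refl) = start↝G last ⨾ reach-step (G↦X last) ⨾ end↝p k , p↝start k

    end↝start : X (pos last) ↝ G zero
    end↝start = end↝p 0F ⨾ p↝start 0F

    between : ∀ v → Between v
    between (X o)       = on-path at-o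
    between (N x)       = on-path (at-N x)
    between (F zero)    = on-path at-F₀
    between (X (pos k)) with view k
    ... | ‵fromℕ     = start↝G last ⨾ reach-step (G↦X last) , end↝start
    ... | ‵inject₁ l = start↝G (inject₁ l) ⨾ reach-step (G↦X (inject₁ l)) ,
                       reach-step (X↦X l) ⨾ reach-step (X↦F l) ⨾ reach-step (F↦G l) ⨾ G↝end (suc l) ⨾ end↝start
    between (X (neg k)) with view k
    ... | ‵fromℕ     = on-path at-last
    ... | ‵inject₁ l = start↝G (inject₁ l) ⨾ reach-step (G↦X (inject₁ l)) ⨾ reach-step (X↦X l) ,
                       reach-step (X↦F l) ⨾ reach-step (F↦G l) ⨾ G↝end (suc l) ⨾ end↝start
    between (F (suc k)) with view k
    ... | ‵fromℕ     = on-path at-Fₜ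
    ... | ‵inject₁ l = start↝G (inject₁ l) ⨾ reach-step (G↦X (inject₁ l)) ⨾ reach-step (X↦X l) ⨾ reach-step (X↦F l) ,
                       reach-step (F↦G l) ⨾ G↝end (suc l) ⨾ end↝start
    between (G j) with view j
    ... | ‵fromℕ     = on-path at-Gₜ
    ... | ‵inject₁ k = start↝G k , G↝end k ⨾ end↝start

    long-cyclic : Cyclic f
    long-cyclic = cyclic-hub (G zero) (proj₁ ∘ between) (proj₂ ∘ between)

  up-last : ∀ k → X (e (up (inject₁ k))) ≡ X (pos k)
  up-last k = cong (X ∘ e) (up-inject₁ k)

  next₁-cyclic : Cyclic next₁
  next₁-cyclic = Long.long-cyclic next₁ up-last (λ _ → refl) (λ l → ifTop-inject₁ _ _ l) (λ l → ifTop-inject₁ _ _ l)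
    (lookup (X (neg last) ∷ N P ∷ G top ∷ X o ∷ F zero ∷ F top ∷ N Q ∷ []))
    refl
    (λ { 0F → ifTop-top _ _ ; 1F → refl ; 2F → cong (X ∘ e) up-top ; 3F → refl ; 4F → refl ; 5F → ifTop-top _ _ })
    refl (3F , refl) (0F , refl) (4F , refl) (5F , refl) (2F , refl)
    λ { P → 1F , refl ; Q → 6F , refl }

  next₂-cyclic : Cyclic next₂
  next₂-cyclic = Long.long-cyclic next₂ up-last (λ l → ifTop-inject₁ _ _ l) (λ _ → refl) (λ l → ifTop-inject₁ _ _ l)
    (lookup (G top ∷ X o ∷ F zero ∷ N Q ∷ X (neg last) ∷ F top ∷ N P ∷ []))
    (ifTop-top _ _)
    (λ { 0F → cong (X ∘ e) up-top ; 1F → refl ; 2F → refl ; 3F → refl ; 4F → refl ; 5F → ifTop-top _ _ })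
    refl (1F , refl) (4F , refl) (2F , refl) (5F , refl) (0F , refl)
    λ { P → 6F , refl ; Q → 3F , refl }

  next₃-cyclic : Cyclic next₃
  next₃-cyclic = Long.long-cyclic next₃ up-last (λ l → ifTop-inject₁ _ _ l) (λ l → ifTop-inject₁ _ _ l) (λ l → ifTop-inject₁ _ _ l)
    (lookup (G top ∷ X o ∷ F zero ∷ F top ∷ N Q ∷ X (neg last) ∷ N P ∷ []))
    (ifTop-top _ _)
    (λ { 0F → cong (X ∘ e) up-top ; 1F → refl ; 2F → refl ; 3F → ifTop-top _ _ ; 4F → refl ; 5F → ifTop-top _ _ })
    refl (1F , refl) (5F , refl) (2F , refl) (3F , refl) (0F , refl)
    λ { P → 6F , refl ; Q → 4F , refl }

  Polygon : Set
  Polygon = Maybe Z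

  -- White: just o and nothing have the orders next₁ and next₂; black: nothing has next₃.
  nextᵂ′ nextᴷ′ : Polygon → V → V
  nextᵂ′ nothing        = next₂
  nextᵂ′ (just o)       = next₁
  nextᵂ′ (just (pos k)) = nextᵂ (pos k)
  nextᵂ′ (just (neg k)) = nextᵂ (neg k)
  nextᴷ′ nothing  = next₃
  nextᴷ′ (just k) = nextᴷ k

  nextᵂ′-cyclic : ∀ i → Cyclic (nextᵂ′ i)
  nextᵂ′-cyclic nothing        = next₂-cyclic
  nextᵂ′-cyclic (just o)       = next₁-cyclic
  nextᵂ′-cyclic (just (pos k)) = nextᵂ-cyclic (pos k)
  nextᵂ′-cyclic (just (neg k)) = nextᵂ-cyclic (neg k)

  nextᴷ′-cyclic : ∀ k → Cyclic (nextᴷ′ k)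
  nextᴷ′-cyclic nothing  = next₃-cyclic
  nextᴷ′-cyclic (just k) = nextᴷ-cyclic k

  -- At v, the polygon W_o of the rotation is replaced by (entry v), the new black
  -- polygon, (exit v), in this order.  The orders next₀ and next₃ alternate between
  -- odd and even vertices, except after F top; this is where the twist is.
  odd : V → Bool
  odd (X o)       = false
  odd (X (pos _)) = false
  odd (X (neg _)) = true
  odd (F zero)    = true
  odd (F (suc _)) = false
  odd (G _)       = true
  odd (N _)       = false

  entryᵇ exitᵇ : Bool → Polygon
  entryᵇ b = if b then just o else nothing
  exitᵇ b  = if b then nothing else just o

  entry exit : V → Polygon
  entry = entryᵇ ∘ odd
  exit  = exitᵇ ∘ odd

  enter : V → Z → Polygon
  enter v o       = entry v
  enter v (pos k) = just (pos k)
  enter v (neg k) = just (neg k)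

  out′ : V → Polygon → Polygon
  out′ v (just o)       = if odd v then nothing else just (out v o)
  out′ v nothing        = if odd v then just (out v o) else nothing
  out′ v (just (pos k)) = just (out v (pos k))
  out′ v (just (neg k)) = just (out v (neg k))

  back′ : V → Polygon → Polygon
  back′ v (just k) = enter v (back v k)
  back′ v nothing  = exit v

  out-entry : ∀ v → out′ v (entry v) ≡ nothing
  out-entry v with odd v in eq
  ... | true  rewrite eq = refl
  ... | false rewrite eq = refl

  out-exit : ∀ v → out′ v (exit v) ≡ just (out v o)
  out-exit v with odd v in eq
  ... | true  rewrite eq = refl
  ... | false rewrite eq = refl

  data PolygonView (v : V) : Polygon → Set where
    ‵pos   : ∀ k → PolygonView v (just (pos k))
    ‵neg   : ∀ k → PolygonView v (just (neg k))
    ‵entry : PolygonView v (entry v)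
    ‵exit  : PolygonView v (exit v)

  polygonView : ∀ v i → PolygonView v i
  polygonView v (just (pos k)) = ‵pos k
  polygonView v (just (neg k)) = ‵neg k
  polygonView v (just o) = go (odd v) refl
    where
    go : ∀ b → odd v ≡ b → PolygonView v (just o)
    go true  eq = subst (PolygonView v) (cong entryᵇ eq) ‵entry
    go false eq = subst (PolygonView v) (cong exitᵇ eq) ‵exit
  polygonView v nothing = go (odd v) refl
    where
    go : ∀ b → odd v ≡ b → PolygonView v nothing
    go true  eq = subst (PolygonView v) (cong exitᵇ eq) ‵exit
    go false eq = subst (PolygonView v) (cong entryᵇ eq) ‵entry

  module _ (v : V) where

    private
      turn′ : Polygon → Polygon
      turn′ i = back′ v (out′ v i)

    entry↝exit : Reach turn′ (entry v) (exit v)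
    entry↝exit = reach-step (cong (back′ v) (out-entry v))

    exit↝ : Reach turn′ (exit v) (enter v (back v (out v o)))
    exit↝ = reach-step (cong (back′ v) (out-exit v))

    -- `enter v` embeds the old rotation as a cross-section of the new one, in which W_0 is
    -- stretched to a path.
    turn′-cyclic : Cyclic turn′
    turn′-cyclic = cyclic-lift (enter v) (turn-cyclic v) lift from to
      where
      lift : ∀ i → Reach turn′ (enter v i) (enter v (back v (out v i)))
      lift o       = entry↝exit ⨾ exit↝
      lift (pos k) = reach-step refl
      lift (neg k) = reach-step refl
      from : ∀ i → ∃[ j ] Reach turn′ (enter v j) i
      from i with polygonView v i
      ... | ‵pos k = pos k , reach-refl
      ... | ‵neg k = neg k , reach-refl
      ... | ‵entry = o , reach-refl
      ... | ‵exit  = o , entry↝exit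
      to : ∀ i → ∃[ j ] Reach turn′ i (enter v j)
      to i with polygonView v i
      ... | ‵pos k = pos k , reach-refl
      ... | ‵neg k = neg k , reach-refl
      ... | ‵entry = o , reach-refl
      ... | ‵exit  = back v (out v o) , exit↝

  out′-onto : ∀ v k → ∃[ i ] out′ v i ≡ k
  out′-onto v nothing = entry v , out-entry v
  out′-onto v (just k) with out-onto v k
  ... | o     , refl = exit v , out-exit v
  ... | pos l , eq   = just (pos l) , cong just eq
  ... | neg l , eq   = just (neg l) , cong just eq

  swap : Polygon → Polygon
  swap nothing        = just o
  swap (just o)       = nothing
  swap (just (pos k)) = just (pos k)
  swap (just (neg k)) = just (neg k)

  twist : V → Polygon → Polygon
  twist (F (suc k)) i = ifTop (swap i) i k
  twist _           i = i

  Quad : V → Polygon → Polygon → V → Set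
  Quad v i j w = j ≡ twist v i × nextᵂ′ (twist v i) v ≡ w

  odd-e : ∀ j → odd (X (e j)) ≡ false
  odd-e zero    = refl
  odd-e (suc _) = refl

  entry-e : ∀ j → entry (X (e j)) ≡ nothing
  entry-e j = cong entryᵇ (odd-e j)

  exit-e : ∀ j → exit (X (e j)) ≡ just o
  exit-e j = cong exitᵇ (odd-e j)

  -- The arc that W_0 shared with an old black polygon passes to `exit v` and arrives in
  -- `entry (next₀ v)`. These are one polygon when `v` and `next₀ v` have opposite parity.
  quad-exit : ∀ v → Quad v (exit v) (entry (next₀ v)) (next₀ v)
  quad-exit (X o)       = refl , refl
  quad-exit (X (pos k)) = refl , refl
  quad-exit (X (neg k)) = refl , refl
  quad-exit (F zero)    = refl , refl
  quad-exit (G j)       = entry-e (up j) , refl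
  quad-exit (N P)       = refl , refl
  quad-exit (N Q)       = refl , refl
  quad-exit (F (suc k)) with view k
  ... | ‵fromℕ     rewrite ifTop-top {A = Polygon} {n = r′} nothing (just o) | ifTop-top {n = r′} (N P) (G top) =
        refl , refl
  ... | ‵inject₁ l rewrite ifTop-inject₁ {A = Polygon} nothing (just o) l | ifTop-inject₁ (N P) (G (suc (inject₁ l))) l =
        refl , ifTop-inject₁ _ _ l

  -- The arcs of the new black polygon, again closed up by the change of parity along `next₃`.
  quad-entry : ∀ v → Quad v (entry v) (exit (next₃ v)) (next₃ v)
  quad-entry (X o)       = refl , refl
  quad-entry (X (pos k)) with view k
  ... | ‵fromℕ     rewrite ifTop-top {n = r′} (G top) (X (neg last)) = refl , refl
  ... | ‵inject₁ l rewrite ifTop-inject₁ (G top) (X (neg (inject₁ l))) l = refl , refl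
  quad-entry (X (neg k)) with view k
  ... | ‵fromℕ     rewrite ifTop-top {n = r′} (N P) (F top) = refl , refl
  ... | ‵inject₁ l rewrite ifTop-inject₁ (N P) (F (suc (inject₁ l))) l = refl , refl
  quad-entry (F zero)    = refl , refl
  quad-entry (G j)       = exit-e (up j) , refl
  quad-entry (N P)       = refl , refl
  quad-entry (N Q)       = refl , refl
  quad-entry (F (suc k)) with view k
  ... | ‵fromℕ     rewrite ifTop-top {A = Polygon} {n = r′} (just o) nothing | ifTop-top {n = r′} (N Q) (G top) =
        refl , refl
  ... | ‵inject₁ l rewrite ifTop-inject₁ {A = Polygon} (just o) nothing l | ifTop-inject₁ (N Q) (G (suc (inject₁ l))) l =
        refl , ifTop-inject₁ _ _ l

  twist-pos : ∀ v k → twist v (just (pos k)) ≡ just (pos k)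
  twist-pos (X _)       k = refl
  twist-pos (F zero)    k = refl
  twist-pos (G _)       k = refl
  twist-pos (N _)       k = refl
  twist-pos (F (suc l)) k with view l
  ... | ‵fromℕ     = ifTop-top _ _
  ... | ‵inject₁ l = ifTop-inject₁ _ _ l

  twist-neg : ∀ v k → twist v (just (neg k)) ≡ just (neg k)
  twist-neg (X _)       k = refl
  twist-neg (F zero)    k = refl
  twist-neg (G _)       k = refl
  twist-neg (N _)       k = refl
  twist-neg (F (suc l)) k with view l
  ... | ‵fromℕ     = ifTop-top _ _
  ... | ‵inject₁ l = ifTop-inject₁ _ _ l

  quad′ : ∀ v i → Quad v i (back′ (nextᴷ′ (out′ v i) v) (out′ v i)) (nextᴷ′ (out′ v i) v)
  quad′ v i with polygonView v i
  ... | ‵pos k rewrite twist-pos v k | proj₁ (quad v (pos k)) = refl , proj₂ (quad v (pos k))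
  ... | ‵neg k rewrite twist-neg v k | proj₁ (quad v (neg k)) = refl , proj₂ (quad v (neg k))
  ... | ‵entry rewrite out-entry v = quad-entry v
  ... | ‵exit  rewrite out-exit v | proj₁ (quad v o) | sym (proj₂ (quad v o)) | nextᵂ-o v = quad-exit v

  V⁻ : Set
  V⁻ = (Fin (suc r) ⊎ Fin r′) ⊎ ((Fin (suc r) ⊎ Fin (suc r)) ⊎ Fin 2)

  ⟦_⟧ : V⁻ → V
  ⟦ inj₁ (inj₁ j) ⟧         = X (e j)
  ⟦ inj₁ (inj₂ l) ⟧         = X (neg (inject₁ l))
  ⟦ inj₂ (inj₁ (inj₁ j)) ⟧  = F j
  ⟦ inj₂ (inj₁ (inj₂ j)) ⟧  = G j
  ⟦ inj₂ (inj₂ 0F) ⟧        = N P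
  ⟦ inj₂ (inj₂ 1F) ⟧        = N Q

  decodeⁿ : ∀ {n} → Fin (suc n) → Maybe (Fin n)
  decodeⁿ k with view k
  ... | ‵fromℕ     = nothing
  ... | ‵inject₁ l = just l

  decode : V → Maybe V⁻
  decode (X o)       = just (inj₁ (inj₁ zero))
  decode (X (pos k)) = just (inj₁ (inj₁ (suc k)))
  decode (X (neg k)) = maybe′ (λ l → just (inj₁ (inj₂ l))) nothing (decodeⁿ k)
  decode (F j)       = just (inj₂ (inj₁ (inj₁ j)))
  decode (G j)       = just (inj₂ (inj₁ (inj₂ j)))
  decode (N P)       = just (inj₂ (inj₂ 0F))
  decode (N Q)       = just (inj₂ (inj₂ 1F))

  decode-∞ : decode (X (neg last)) ≡ nothing
  decode-∞ rewrite view-fromℕ r′ = refl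

  decode-⟦⟧ : ∀ b → decode ⟦ b ⟧ ≡ just b
  decode-⟦⟧ (inj₁ (inj₁ zero))     = refl
  decode-⟦⟧ (inj₁ (inj₁ (suc _)))  = refl
  decode-⟦⟧ (inj₁ (inj₂ l)) rewrite view-inject₁ l = refl
  decode-⟦⟧ (inj₂ (inj₁ (inj₁ _))) = refl
  decode-⟦⟧ (inj₂ (inj₁ (inj₂ _))) = refl
  decode-⟦⟧ (inj₂ (inj₂ 0F))       = refl
  decode-⟦⟧ (inj₂ (inj₂ 1F))       = refl

  split : ∀ v → v ≡ X (neg last) ⊎ ∃[ b ] v ≡ ⟦ b ⟧
  split (X o)       = inj₂ (inj₁ (inj₁ zero) , refl)
  split (X (pos k)) = inj₂ (inj₁ (inj₁ (suc k)) , refl)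
  split (X (neg k)) with view k
  ... | ‵fromℕ     = inj₁ refl
  ... | ‵inject₁ l = inj₂ (inj₁ (inj₂ l) , refl)
  split (F j)       = inj₂ (inj₂ (inj₁ (inj₁ j)) , refl)
  split (G j)       = inj₂ (inj₂ (inj₁ (inj₂ j)) , refl)
  split (N P)       = inj₂ (inj₂ (inj₂ 0F) , refl)
  split (N Q)       = inj₂ (inj₂ (inj₂ 1F) , refl)

  -- The surgery keeps all arcs x → x of W_0 in `next₁`, so the x's remain joined to `∞` as before.
  next₁-X : ∀ y {z} → next₀ (X y) ≡ X z → next₁ (X y) ≡ X z
  next₁-X (pos k) eq = eq

  fromWhite-X : ∀ i y {z} → nextᵂ i (X y) ≡ X z → nextᵂ′ (just i) (X y) ≡ X z
  fromWhite-X o       y eq = next₁-X y (trans (sym (nextᵂ-o (X y))) eq)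
  fromWhite-X (pos k) y eq = eq
  fromWhite-X (neg k) y eq = eq

  fromWhite-G : ∀ i j {z} → nextᵂ i (G j) ≡ X z → nextᵂ′ (just i) (G j) ≡ X z
  fromWhite-G o       j eq = trans (sym (nextᵂ-o (G j))) eq
  fromWhite-G (pos k) j eq = eq
  fromWhite-G (neg k) j eq = eq

  Spanned : V → Set
  Spanned v = (∃[ i ] nextᵂ′ i v ≡ X (neg last)) ⊎ (∃[ k ] nextᴷ′ k (X (neg last)) ≡ v)

  spans-X : ∀ y → y ≢ neg last → Spanned (X y)
  spans-X y y≢ with neighbour-X (neg last) y y≢
  ... | inj₁ (k , eq) = inj₁ (just (neg last ⊕ pos k) , fromWhite-X _ y eq)
  ... | inj₂ (k , eq) = inj₂ (just k , eq)

  spans : ∀ b → Spanned ⟦ b ⟧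
  spans (inj₁ (inj₁ zero))     = spans-X o λ ()
  spans (inj₁ (inj₁ (suc k)))  = spans-X (pos k) λ ()
  spans (inj₁ (inj₂ l))        = spans-X (neg (inject₁ l)) λ eq → Fin.fromℕ≢inject₁ (sym (neg-injective eq))
    where
    neg-injective : ∀ {k l : Fin r} → neg k ≡ neg l → k ≡ l
    neg-injective refl = refl
  spans (inj₂ (inj₁ (inj₁ j))) = let k , eq = next-to-F (neg last) j in inj₂ (just k , eq)
  spans (inj₂ (inj₁ (inj₂ j))) = inj₁ (just (neg last ⊖ e (up j)) , fromWhite-G _ j (next-from-G (neg last) j))
  spans (inj₂ (inj₂ 0F))       = inj₂ (nothing , ifTop-top _ _)
  spans (inj₂ (inj₂ 1F))       = inj₁ (nothing , refl)

  -- No polygon leads from an f to an x. Thus the vertex of the octagon, `F top`, never precedes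
  -- `∞`.
  X? : V → Bool
  X? (X _) = true
  X? _     = false

  X?-ifTop : ∀ {n} x k l → X? (ifTop {n = n} (N x) (G k) l) ≡ false
  X?-ifTop x k l with view l
  ... | ‵fromℕ     = cong X? (ifTop-top _ _)
  ... | ‵inject₁ l = cong X? (ifTop-inject₁ _ _ l)

  X?-next-F : ∀ i j → X? (nextᵂ i (F j)) ≡ false
  X?-next-F i j with Detours.detour twoDetours j
  ... | just _  = refl
  ... | nothing = refl

  X?-next′-F : ∀ i j → X? (nextᵂ′ i (F j)) ≡ false
  X?-next′-F nothing        zero    = refl
  X?-next′-F (just o)       zero    = refl
  X?-next′-F nothing        (suc k) = X?-ifTop P (suc k) k
  X?-next′-F (just o)       (suc k) = X?-ifTop Q (suc k) k
  X?-next′-F (just (pos k)) j       = X?-next-F (pos k) j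
  X?-next′-F (just (neg k)) j       = X?-next-F (neg k) j

  next-F≢∞ : ∀ j i → nextᵂ′ i (F j) ≢ X (neg last)
  next-F≢∞ j i eq with () ← trans (sym (X?-next′-F i j)) (cong X? eq)

  twist-before-∞ : ∀ v → (∀ i → twist v i ≡ i) ⊎ (∀ i → nextᵂ′ i v ≢ X (neg last))
  twist-before-∞ (X _) = inj₁ λ _ → refl
  twist-before-∞ (G _) = inj₁ λ _ → refl
  twist-before-∞ (N _) = inj₁ λ _ → refl
  twist-before-∞ (F j) = inj₂ (next-F≢∞ j)

  twist-id : ∀ v i → twist v i ≡ i ⊎ (v ≡ F top × (i ≡ just o ⊎ i ≡ nothing))
  twist-id (X _)       i              = inj₁ refl
  twist-id (G _)       i              = inj₁ refl
  twist-id (N _)       i              = inj₁ refl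
  twist-id (F zero)    i              = inj₁ refl
  twist-id v@(F (suc k)) (just (pos l)) = inj₁ (twist-pos v l)
  twist-id v@(F (suc k)) (just (neg l)) = inj₁ (twist-neg v l)
  twist-id (F (suc k)) (just o) with view k
  ... | ‵fromℕ     = inj₂ (refl , inj₁ refl)
  ... | ‵inject₁ l = inj₁ (ifTop-inject₁ _ _ l)
  twist-id (F (suc k)) nothing with view k
  ... | ‵fromℕ     = inj₂ (refl , inj₂ refl)
  ... | ‵inject₁ l = inj₁ (ifTop-inject₁ _ _ l)

  gluing : Gluing Polygon Polygon V V⁻
  gluing = record
    { ∞ = X (neg last) ; ⟦_⟧ = ⟦_⟧ ; decode = decode ; decode-∞ = decode-∞ ; decode-⟦⟧ = decode-⟦⟧
    ; split = split ; nextᵂ = nextᵂ′ ; nextᴷ = nextᴷ′ ; nextᵂ-cyclic = nextᵂ′-cyclic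
    ; nextᴷ-cyclic = nextᴷ′-cyclic ; out = out′ ; back = back′ ; turn-cyclic = turn′-cyclic
    ; out-onto = out′-onto ; twist = twist ; quad = quad′ ; twist-∞ = λ _ → refl
    ; twist-before-∞ = twist-before-∞ ; spans = spans }

  polygon↔ : Polygon ↔ Fin (2 + (r + r))
  polygon↔ = mk↔ₛ′ to from to-from from-to
    where
    ρ = residue↔ r
    to : Polygon → Fin (2 + (r + r))
    to nothing  = zero
    to (just x) = suc (Inverse.to ρ x)
    from : Fin (2 + (r + r)) → Polygon
    from zero    = nothing
    from (suc k) = just (Inverse.from ρ k)
    to-from : ∀ k → to (from k) ≡ k
    to-from zero    = refl
    to-from (suc k) = cong suc (Inverse.strictlyInverseˡ ρ k)
    from-to : ∀ i → from (to i) ≡ i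
    from-to nothing  = refl
    from-to (just x) = cong just (Inverse.strictlyInverseʳ ρ x)

  open +-*-Solver

  V⁻↔ : V⁻ ↔ Fin (4 + r * 4)
  V⁻↔ = subst (λ l → V⁻ ↔ Fin l)
    (solve 1 (λ t → con 2 :+ t :+ t :+ (con 2 :+ t :+ (con 2 :+ t) :+ con 2) :=
                    con 4 :+ (con 1 :+ t) :* con 4) refl r′)
    (↔-sym Fin.+↔⊎ ↔-∘ (↔-sym Fin.+↔⊎ ⊎-↔ (↔-sym Fin.+↔⊎ ↔-∘ (↔-sym Fin.+↔⊎ ⊎-↔ ↔-id _))))

  hamiltonianFace-even : HamiltonianFace (4 + r * 4) (4 * (r * r) + 5 * r + 2)
  hamiltonianFace-even = hamiltonianFace-of
    (turnClasses-twisted (inj₂ (inj₁ (inj₁ top))) (just o) nothing (λ ()) (next-F≢∞ top)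
      (ifTop-top _ _) (ifTop-top _ _) twist-id)
    (solve 1 (λ r → con 4 :+ r :* con 4 :+ (con 4 :+ r :* con 4) :+
                    (con 2 :+ (r :+ r)) :* (con 3 :+ r :* con 4) :+
                    con 2 :* (con 4 :* (r :* r) :+ con 5 :* r :+ con 2) :=
                    (con 4 :+ r :* con 4) :* (con 4 :+ r :* con 4) :+ con 2) refl r)
    where
    open Assemble gluing polygon↔ polygon↔ V⁻↔
      (solve 1 (λ r → con 2 :+ (r :+ r) :+ (con 2 :+ (r :+ r)) := con 4 :+ r :* con 4) refl r) nothing

-- The ceiling, and the cases put together.

ceiling : ∀ {x} c g → c < 4 → x + 3 ≡ c + g * 4 → ⌈ x /4⌉ ≡ g
ceiling {x} c g c<4 eq = begin
  (x + 3) / 4          ≡⟨ cong (_/ 4) eq ⟩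
  (c + g * 4) / 4      ≡⟨ +-distrib-/-∣ʳ c (n∣m*n g) ⟩
  c / 4 + g * 4 / 4    ≡⟨ cong₂ _+_ (m<n⇒m/n≡0 c<4) (m*n/n≡m g 4) ⟩
  g                    ∎
  where open ≡-Reasoning

parity : ∀ n → ∃[ r ] (n ≡ r + r ⊎ n ≡ suc (r + r))
parity zero = 0 , inj₁ refl
parity (suc n) with parity n
... | r , inj₁ refl = r , inj₂ refl
... | r , inj₂ refl = suc r , inj₁ (cong suc (sym (ℕ.+-suc r r)))

-- For q = 2r, n = 4r + 2 and the division by 4 is exact (c = 3 in `ceiling`); for q = 2r + 1, n =
-- 4r + 4 and (n - 1)(n - 2) leaves remainder 2 (c = 1).
minimalHamiltonianFace : ∀ q → let n = suc q * 2 in HamiltonianFace n ⌈ (n ∸ 1) * (n ∸ 2) /4⌉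
minimalHamiltonianFace q with parity q
... | r , inj₁ refl =
  subst (λ n → HamiltonianFace n ⌈ (n ∸ 1) * (n ∸ 2) /4⌉)
    (solve 1 (λ r → con 2 :+ r :* con 4 := (con 1 :+ (r :+ r)) :* con 2) refl r)
    (subst (HamiltonianFace (2 + r * 4))
      (sym (ceiling {(1 + r * 4) * (r * 4)} 3 ((1 + r * 4) * r) ℕ.≤-refl
        (solve 1 (λ r → (con 1 :+ r :* con 4) :* (r :* con 4) :+ con 3 :=
                        con 3 :+ (con 1 :+ r :* con 4) :* r :* con 4) refl r)))
      (Odd.hamiltonianFace-odd r))
  where open +-*-Solver
... | zero , inj₂ refl = K₄₄.hamiltonianFace₄
... | suc r′ , inj₂ refl =
  subst (λ n → HamiltonianFace n ⌈ (n ∸ 1) * (n ∸ 2) /4⌉)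
    (solve 1 (λ r → con 4 :+ r :* con 4 := (con 2 :+ (r :+ r)) :* con 2) refl r)
    (subst (HamiltonianFace (4 + r * 4))
      (sym (ceiling {(3 + r * 4) * (2 + r * 4)} 1 (4 * (r * r) + 5 * r + 2) (s≤s (s≤s z≤n))
        (solve 1 (λ r → (con 3 :+ r :* con 4) :* (con 2 :+ r :* con 4) :+ con 3 :=
                        con 1 :+ (con 4 :* (r :* r) :+ con 5 :* r :+ con 2) :* con 4) refl r)))
      (Even.hamiltonianFace-even r′))
  where
  open +-*-Solver
  r = suc r′

theorem1 : (n : ℕ) → 0 < n → 2 ∣ n →
    Σ[ E ∈ TwoCellEmbedding (completeBipartite n n) ⌈ (n ∸ 1) * (n ∸ 2) /4⌉ ]
    Σ[ F ∈ TwoCellEmbedding.Face E ]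
    Σ[ C ∈ Cycle (completeBipartite n n) ]
    (Hamiltonian (completeBipartite n n) C × BoundedBy (completeBipartite n n) E F C)
theorem1 _ () (divides zero refl)
theorem1 _ _  (divides (suc q) refl) = minimalHamiltonianFace q
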